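{- There exists a positive integer $n_0$ such that for all integers $n\geq n_0$ and $k$ with $2\leq k\leq \frac{n}{2}$ we have \[\vec\chi(KG(n,k))\geq\left\lfloor \tfrac{1}{16}\chi(KG(n,k))\right\rfloor.\]
   Context: The Kneser graph $KG(n,k)$ is the graph with vertex set $\binom{[n]}{k}$ (the $k$-subsets of $[n]=\{1,\dots,n\}$), two vertices being adjacent iff they are disjoint sets. $\chi$ denotes the chromatic number. For a digraph $D$, a proper $k$-colouring is a map $f:V(D)\to[k]$ such that each colour class $f^{ -1}(i)$ induces an acyclic subdigraph (no directed cycle); the dichromatic number $\vec\chi(D)$ is the least $k$ admitting a proper $k$-colouring. For an undirected graph $G$, $\vec\chi(G)$ is the maximum of $\vec\chi(D)$ over all orientations $D$ of $G$. -}

module Defs where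

open import Level using (Level; suc; _⊔_) renaming (zero to lzero)
open import Data.Nat using (ℕ; zero; _≤_)
open import Data.Fin using (Fin; inject₁; fromℕ) renaming (zero to fzero; suc to fsuc)
open import Data.Fin.Subset using (Subset; ∣_∣; _∩_; Empty)
open import Data.Product using (Σ; ∃; ∃-syntax; _×_; _,_; proj₁)
open import Data.Sum using (_⊎_)
open import Data.Empty using (⊥)
open import Relation.Nullary using (¬_)
open import Relation.Binary using (Decidable)
open import Relation.Binary.PropositionalEquality using (_≡_; _≢_)
open import Function.Definitions using (Injective)

record Graph : Set₁ where
  field
    V   : Set
    Adj : V → V → Set
open Graph public

KG : ℕ → ℕ → Graph
KG n k = record
  { V   = Σ (Subset n) (λ s → ∣ s ∣ ≡ k)
  ; Adj = λ u v → Empty (proj₁ u ∩ proj₁ v)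
  }

Colourable : Graph → ℕ → Set
Colourable G c = Σ (V G → Fin c) (λ f → ∀ {u v} → Adj G u v → f u ≢ f v)

IsChromaticNumber : Graph → ℕ → Set
IsChromaticNumber G c = Colourable G c × (∀ c′ → Colourable G c′ → c ≤ c′)

record Orientation (G : Graph) : Set₁ where
  field
    Arc   : V G → V G → Set
    Arc?  : Decidable Arc
    along : ∀ {u v} → Arc u v → Adj G u v
    total : ∀ {u v} → Adj G u v → Arc u v ⊎ Arc v u
    anti  : ∀ {u v} → Arc u v → Arc v u → ⊥
open Orientation public

record DirectedCycleIn {G : Graph} (D : Orientation G) (P : V G → Set) : Set where
  field
    m     : ℕ
    w     : Fin (Data.Nat.suc m) → V G
    inj   : Injective _≡_ _≡_ w
    inP   : ∀ i → P (w i)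
    step  : ∀ (i : Fin m) → Arc D (w (inject₁ i)) (w (fsuc i))
    close : Arc D (w (fromℕ m)) (w fzero)

DiColourable : {G : Graph} → Orientation G → ℕ → Set
DiColourable {G} D c =
  Σ (V G → Fin c) (λ f → ∀ (i : Fin c) → ¬ DirectedCycleIn D (λ v → f v ≡ i))

IsDichromaticNumber : {G : Graph} → Orientation G → ℕ → Set
IsDichromaticNumber D d = DiColourable D d × (∀ d′ → DiColourable D d′ → d ≤ d′)

IsGraphDichromaticNumber : Graph → ℕ → Set₁
IsGraphDichromaticNumber G d =
  (∃[ D ] IsDichromaticNumber {G} D d)
  × (∀ (D : Orientation G) d′ → IsDichromaticNumber D d′ → d′ ≤ d)

{-# OPTIONS --safe #-}

-- Orient the edge between two vertices u, v as in a tournament without r vertices that all beat r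
-- others; it exists by counting once r > 2 log₂ of the number of vertices. Let the vertices be
-- coloured with m < χ / 16 ≤ (n − 2k + 2) / 16 colours. Call a colour popular in a set A if it occurs
-- at least 2r times among the k-subsets of A; for s = ⌊(n − 2k) / 4⌋ and |A| ≥ k + s some colour is
-- popular in A. If a colour is popular in two disjoint sets, it contains a bipartite tournament on
-- 2r + 2r vertices, which has a directed 4-cycle, since otherwise its out-neighbourhoods
-- would be nested, giving r vertices that beat r others.
-- That some colour is popular in two disjoint sets is proved as in the Lovász–Kneser theorem.
-- Otherwise, give a sign vector x = (A , B) the sign of the side where its least popular colour lives.
-- This sign is antipodal, so by a parity count there is a maximal chain of sign vectors along which it
-- alternates (a form of Fan's lemma). Along that chain the least popular colour strictly decreases
-- n + 1 − 2 (k + s) ≥ m times, which is impossible.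
module Submission where

open import Defs
open import Algebra.Properties.CommutativeSemigroup using (interchange)
open import Data.Bool using (Bool; true; false; not; _∧_; _∨_; _xor_; if_then_else_; T?)
import Data.Bool.Properties as Bool
open import Data.Bool.Properties using (T-≡; not-¬; ¬-not; not-involutive; ∧-zeroʳ; ∨-comm; ∨-zeroʳ; xor-same; xor-comm; xor-identityʳ)
open import Data.Empty using (⊥; ⊥-elim)
open import Data.Fin using (Fin; combine; toℕ; inject₁; fromℕ) renaming (zero to fzero; suc to fsuc)
import Data.Fin.Properties as Fin
open import Data.Fin.Properties using (combine-injective; toℕ-injective; toℕ<n)
open import Data.Fin.Subset using (Subset; ∣_∣; _∩_; Empty)
open import Data.Fin.Subset.Properties using (x∈p∩q⁻; drop-∷-Empty; nonempty?; Empty-unique; ∩-idem; ∩-comm; ∣⊥∣≡0)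
open import Data.List using (List; []; _∷_; _++_; length; filter; filterᵇ; take; allFin; cartesianProduct; cartesianProductWith)
import Data.List as List
open import Data.List.Membership.Propositional using (_∈_; _∉_)
open import Data.List.Membership.Propositional.Properties using (∈-filter⁺; ∈-filter⁻; ∈-allFin; ∈-map⁺; ∈-map⁻; ∈-++⁺ˡ; ∈-++⁺ʳ; ∈-cartesianProduct⁺; ∈-cartesianProduct⁻; ∈-cartesianProductWith⁺)
open import Data.List.Properties using (length-filter; length-map; length-++; length-tabulate; length-take; map-∘)
open import Data.List.Relation.Unary.All using (All; []; _∷_)
import Data.List.Relation.Unary.All as All
import Data.List.Relation.Unary.All.Properties as All
open import Data.List.Relation.Unary.AllPairs using ([]; _∷_)
open import Data.List.Relation.Unary.Any using (here; there)
import Data.List.Relation.Unary.Any as Any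
import Data.List.Relation.Unary.Any.Properties as Any using (lookup-index)
open import Data.List.Relation.Unary.Unique.Propositional using (Unique)
import Data.List.Relation.Unary.Unique.Propositional.Properties as Unique
open import Data.Maybe using (Maybe; just; nothing)
import Data.Maybe as Maybe
open import Data.Maybe.Properties using (just-injective)
open import Data.Nat using (ℕ; zero; suc; _+_; _*_; _^_; _∸_; _/_; _%_; _≤_; _<_; z≤n; s≤s; _<?_; _≤?_; _≤ᵇ_; _<ᵇ_; _≡ᵇ_; >-nonZero)
open import Data.Nat.DivMod using (m≡m%n+[m/n]*n; m%n<n; m/n*n≤m)
open import Data.Nat.Properties
open import Data.Nat.Tactic.RingSolver using (solve-∀)
open import Data.Product using (Σ; ∃-syntax; _×_; _,_; proj₁; proj₂)
open import Data.Sum using (_⊎_; inj₁; inj₂)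
open import Data.Vec using (Vec; []; _∷_; map; tail; lookup; replicate; _[_]≔_; _[_]=_; here; there)
open import Data.Vec.Properties using (lookup∘update; lookup∘update′; lookup-replicate)
open import Function using (_∘_; flip)
open import Function.Bundles using (Equivalence)
open import Relation.Binary.PropositionalEquality
open import Relation.Nullary using (¬_; yes; no; _×-dec_; ¬?)

-- Alternating chains of sign vectors

xor-interchange : ∀ a b c d → (a xor b) xor (c xor d) ≡ (a xor c) xor (b xor d)
xor-interchange false false c d = refl
xor-interchange false true false d = refl
xor-interchange false true true d = refl
xor-interchange true false false d = refl
xor-interchange true false true false = refl
xor-interchange true false true true = refl
xor-interchange true true false d = sym (not-involutive d)
xor-interchange true true true d = refl

xor-cancel-middle : ∀ a b → a xor (a xor b) ≡ b
xor-cancel-middle false b = refl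
xor-cancel-middle true b = not-involutive b

xor≡false⇒≡ : ∀ a b → a xor b ≡ false → a ≡ b
xor≡false⇒≡ false b e = sym e
xor≡false⇒≡ true true e = refl

split-∧ : ∀ a b → (a ∧ b) xor (not a ∧ b) ≡ b
split-∧ false b = refl
split-∧ true false = refl
split-∧ true true = refl

∧-true : ∀ {a b} → a ∧ b ≡ true → a ≡ true × b ≡ true
∧-true {true} e = refl , e

-- Sign vectors: just true is +, just false is −, nothing is 0.
SV : ℕ → Set
SV n = Vec (Maybe Bool) n

neg : ∀ {n} → SV n → SV n
neg = map (Maybe.map not)

size : ∀ {n} → SV n → ℕ
size [] = 0
size (nothing ∷ x) = size x
size (just _ ∷ x) = suc (size x)

infix 4 _⋖_
-- The covering relation in the face poset of the cross-polytope, where the zero vector stands for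
-- the empty face.
data _⋖_ : ∀ {n} → SV n → SV n → Set where
  drop  : ∀ {n b} {x : SV n} → nothing ∷ x ⋖ just b ∷ x
  keep : ∀ {n a} {y x : SV n} → y ⋖ x → a ∷ y ⋖ a ∷ x

⋖-size : ∀ {n} {y x : SV n} → y ⋖ x → size x ≡ suc (size y)
⋖-size drop = refl
⋖-size (keep {a = nothing} p) = ⋖-size p
⋖-size (keep {a = just _} p) = cong suc (⋖-size p)

-- With `xor` as addition modulo 2, this is the coboundary of the cochain g on that poset.
coverSum : ∀ {n} → (SV n → Bool) → SV n → Bool
coverSum g [] = false
coverSum g (nothing ∷ x) = coverSum (λ y → g (nothing ∷ y)) x
coverSum g (just b ∷ x) = g (nothing ∷ x) xor coverSum (λ y → g (just b ∷ y)) x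

coverSum-cong : ∀ {n} {g h : SV n → Bool} x → (∀ y → y ⋖ x → g y ≡ h y) → coverSum g x ≡ coverSum h x
coverSum-cong [] e = refl
coverSum-cong (nothing ∷ x) e = coverSum-cong x (λ y p → e _ (keep p))
coverSum-cong (just b ∷ x) e = cong₂ _xor_ (e _ drop) (coverSum-cong x (λ y p → e _ (keep p)))

coverSum-xor : ∀ {n} (g h : SV n → Bool) x → coverSum (λ y → g y xor h y) x ≡ coverSum g x xor coverSum h x
coverSum-xor g h [] = refl
coverSum-xor g h (nothing ∷ x) = coverSum-xor _ _ x
coverSum-xor g h (just b ∷ x) =
  trans (cong ((g (nothing ∷ x) xor h (nothing ∷ x)) xor_) (coverSum-xor _ _ x))
        (xor-interchange (g (nothing ∷ x)) (h (nothing ∷ x)) _ _)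

-- Two coordinates can be set to zero in either order, so every vector two levels below x is reached
-- twice and cancels.
coverSum² : ∀ {n} (g : SV n → Bool) x → coverSum (coverSum g) x ≡ false
coverSum² g [] = refl
coverSum² g (nothing ∷ x) = coverSum² _ x
coverSum² g (just b ∷ x) = begin
  c₀ xor coverSum (λ y → g (nothing ∷ y) xor coverSum (λ z → g (just b ∷ z)) y) x
    ≡⟨ cong (c₀ xor_) (coverSum-xor _ _ x) ⟩
  c₀ xor (c₀ xor coverSum (coverSum (λ z → g (just b ∷ z))) x)
    ≡⟨ xor-cancel-middle c₀ _ ⟩
  coverSum (coverSum (λ z → g (just b ∷ z))) x
    ≡⟨ coverSum² _ x ⟩
  false ∎
  where
  open ≡-Reasoning
  c₀ = coverSum (λ y → g (nothing ∷ y)) x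

coverSum-neg : ∀ {n} (g : SV n → Bool) x → coverSum g (neg x) ≡ coverSum (g ∘ neg) x
coverSum-neg g [] = refl
coverSum-neg g (nothing ∷ x) = coverSum-neg _ x
coverSum-neg g (just b ∷ x) = cong (g (nothing ∷ neg x) xor_) (coverSum-neg _ x)

coverSum-true : ∀ {n} (g : SV n → Bool) x → coverSum g x ≡ true → ∃[ y ] (y ⋖ x × g y ≡ true)
coverSum-true g (nothing ∷ x) e with y , p , gy ← coverSum-true _ x e = _ , keep p , gy
coverSum-true g (just b ∷ x) e with g (nothing ∷ x) in eq
... | true = _ , drop , eq
... | false with y , p , gy ← coverSum-true _ x e = _ , keep p , gy

fullSum : ∀ n → (SV n → Bool) → Bool
fullSum zero g = g []
fullSum (suc n) g = fullSum n (λ x → g (just true ∷ x)) xor fullSum n (λ x → g (just false ∷ x))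

fullSum-cong : ∀ n {g h : SV n → Bool} → (∀ x → size x ≡ n → g x ≡ h x) → fullSum n g ≡ fullSum n h
fullSum-cong zero e = e [] refl
fullSum-cong (suc n) e =
  cong₂ _xor_ (fullSum-cong n (λ x p → e _ (cong suc p))) (fullSum-cong n (λ x p → e _ (cong suc p)))

fullSum-xor : ∀ n (g h : SV n → Bool) → fullSum n (λ x → g x xor h x) ≡ fullSum n g xor fullSum n h
fullSum-xor zero g h = refl
fullSum-xor (suc n) g h =
  trans (cong₂ _xor_ (fullSum-xor n _ _) (fullSum-xor n _ _)) (xor-interchange (fullSum n _) _ _ _)

fullSum-neg : ∀ n (g : SV n → Bool) → fullSum n (g ∘ neg) ≡ fullSum n g
fullSum-neg zero g = refl
fullSum-neg (suc n) g =
  trans (cong₂ _xor_ (fullSum-neg n (λ x → g (just false ∷ x))) (fullSum-neg n (λ x → g (just true ∷ x))))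
        (xor-comm (fullSum n (λ x → g (just false ∷ x))) _)

-- Zeroing a coordinate of a full vector forgets its sign, so each facet is counted twice.
fullSum-coverSum : ∀ n (g : SV n → Bool) → fullSum n (coverSum g) ≡ false
fullSum-coverSum zero g = refl
fullSum-coverSum (suc n) g = begin
  fullSum n (λ x → g (nothing ∷ x) xor coverSum (λ y → g (just true ∷ y)) x)
    xor fullSum n (λ x → g (nothing ∷ x) xor coverSum (λ y → g (just false ∷ y)) x)
    ≡⟨ cong₂ _xor_ (half true) (half false) ⟩
  f₀ xor f₀
    ≡⟨ xor-same f₀ ⟩
  false ∎
  where
  open ≡-Reasoning
  f₀ = fullSum n (λ x → g (nothing ∷ x))
  half : ∀ b → fullSum n (λ x → g (nothing ∷ x) xor coverSum (λ y → g (just b ∷ y)) x) ≡ f₀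
  half b = trans (fullSum-xor n _ _) (trans (cong (f₀ xor_) (fullSum-coverSum n _)) (xor-identityʳ f₀))

fullSum-true : ∀ n (g : SV n → Bool) → fullSum n g ≡ true → ∃[ x ] (size x ≡ n × g x ≡ true)
fullSum-true zero g e = [] , refl , e
fullSum-true (suc n) g e with fullSum n (λ x → g (just true ∷ x)) in eq
... | true with x , p , q ← fullSum-true n _ eq = _ , cong suc p , q
... | false with x , p , q ← fullSum-true n _ e = _ , cong suc p , q

-- The zero vector equals its own negative and has to be exempted.
Antipodal : ∀ {n} → (SV n → Bool) → Set
Antipodal s = ∀ x → 0 < size x → s (neg x) ≡ not (s x)

-- When size x = i + 1, this is the parity of the number of maximal chains ending at x along which
-- s alternates: summing over the covered y with s y = − gives the same parity (chainParity-minus).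
chainParity : ∀ {n} → (SV n → Bool) → ℕ → SV n → Bool
chainParity s zero x = true
chainParity s (suc i) x = coverSum (λ y → s y ∧ chainParity s i y) x

private
  odd : ℕ → Bool
  odd zero = false
  odd (suc n) = not (odd n)

coverSum-one : ∀ {n} (x : SV n) → coverSum (λ _ → true) x ≡ odd (size x)
coverSum-one [] = refl
coverSum-one (nothing ∷ x) = coverSum-one x
coverSum-one (just _ ∷ x) = cong not (coverSum-one x)

-- For i = 0 exactly two vectors are covered; for larger i the summand is itself a coboundary and
-- `coverSum²` applies.
coverSum-chainParity : ∀ {n} (s : SV n → Bool) i x → size x ≡ 2 + i → coverSum (chainParity s i) x ≡ false
coverSum-chainParity s zero x p = trans (coverSum-one x) (cong odd p)
coverSum-chainParity s (suc i) x p = coverSum² _ x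

-- The sums over the covered y of sign + and of sign - add up to `coverSum (chainParity s i) x`,
-- which vanishes, so they agree modulo 2.
chainParity-minus : ∀ {n} (s : SV n → Bool) i x → size x ≡ 2 + i →
  coverSum (λ y → not (s y) ∧ chainParity s i y) x ≡ chainParity s (suc i) x
chainParity-minus s i x p = sym (xor≡false⇒≡ _ _ (begin
  coverSum (λ y → s y ∧ chainParity s i y) x xor coverSum (λ y → not (s y) ∧ chainParity s i y) x
    ≡⟨ coverSum-xor _ _ x ⟨
  coverSum (λ y → (s y ∧ chainParity s i y) xor (not (s y) ∧ chainParity s i y)) x
    ≡⟨ coverSum-cong x (λ y _ → split-∧ (s y) _) ⟩
  coverSum (chainParity s i) x
    ≡⟨ coverSum-chainParity s i x p ⟩
  false ∎))
  where open ≡-Reasoning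

-- An odd sum has a nonzero term. Since the partial sums for both signs agree, y can be given the
-- sign opposite to that of x, which prolongs an alternating chain downwards.
alternating-step : ∀ {n} (s : SV n → Bool) i x → size x ≡ 2 + i → chainParity s (suc i) x ≡ true →
  ∀ b → ∃[ y ] (y ⋖ x × s y ≡ b × chainParity s i y ≡ true)
alternating-step s i x p c true with y , q , e ← coverSum-true _ x c = y , q , ∧-true e
alternating-step s i x p c false
  with y , q , e ← coverSum-true _ x (trans (chainParity-minus s i x p) c) =
  y , q , trans (sym (not-involutive (s y))) (cong not (proj₁ (∧-true e))) , proj₂ (∧-true {not (s y)} e)

-- Negation exchanges the covered vectors of sign + with those of sign -, and `chainParity-minus`
-- equates the two sums.
chainParity-neg : ∀ {n} (s : SV n → Bool) → Antipodal s → ∀ i x → size x ≡ suc i →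
  chainParity s i (neg x) ≡ chainParity s i x
chainParity-neg s anti zero x p = refl
chainParity-neg s anti (suc i) x p = begin
  coverSum (λ y → s y ∧ chainParity s i y) (neg x)
    ≡⟨ coverSum-neg _ x ⟩
  coverSum (λ y → s (neg y) ∧ chainParity s i (neg y)) x
    ≡⟨ coverSum-cong x (λ y q → let e = suc-injective (trans (sym (⋖-size q)) p) in
         cong₂ _∧_ (anti y (subst (0 <_) (sym e) (s≤s z≤n))) (chainParity-neg s anti i y e)) ⟩
  coverSum (λ y → not (s y) ∧ chainParity s i y) x
    ≡⟨ chainParity-minus s i x p ⟩
  chainParity s (suc i) x ∎
  where open ≡-Reasoning

chainParity-nothing : ∀ {n} (s : SV (suc n) → Bool) i x →
  chainParity s i (nothing ∷ x) ≡ chainParity (λ y → s (nothing ∷ y)) i x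
chainParity-nothing s zero x = refl
chainParity-nothing s (suc i) x = coverSum-cong x (λ y _ → cong (s (nothing ∷ y) ∧_) (chainParity-nothing s i y))

-- Fan's lemma in parity form, by induction on the dimension. Within the hemisphere everything
-- cancels by `fullSum-coverSum`, so only the equator contributes. There antipodality folds one half
-- onto the other: the sum over both halves with sign + becomes the sum over one half with both
-- signs, which is the claim one dimension lower.
hemisphere : ∀ n (s : SV (suc n) → Bool) → Antipodal s →
  fullSum n (λ x → chainParity s n (just true ∷ x)) ≡ true
hemisphere zero s anti = refl
hemisphere (suc n) s anti = begin
  fullSum (suc n) (λ x → g (nothing ∷ x) xor coverSum (λ y → g (just true ∷ y)) x)
    ≡⟨ fullSum-xor (suc n) (λ x → g (nothing ∷ x)) (coverSum (λ y → g (just true ∷ y))) ⟩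
  fullSum (suc n) (λ x → g (nothing ∷ x)) xor fullSum (suc n) (coverSum (λ y → g (just true ∷ y)))
    ≡⟨ cong₂ _xor_ (fullSum-cong (suc n) (λ x _ → cong (s (nothing ∷ x) ∧_) (chainParity-nothing s n x)))
                   (fullSum-coverSum (suc n) (λ y → g (just true ∷ y))) ⟩
  (fullSum n h xor fullSum n (λ x → s′ (just false ∷ x) ∧ chainParity s′ n (just false ∷ x))) xor false
    ≡⟨ xor-identityʳ _ ⟩
  fullSum n h xor fullSum n (λ x → s′ (just false ∷ x) ∧ chainParity s′ n (just false ∷ x))
    ≡⟨ cong (fullSum n h xor_) (fullSum-neg n _) ⟨
  fullSum n h xor fullSum n (λ x → s′ (neg (just true ∷ x)) ∧ chainParity s′ n (neg (just true ∷ x)))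
    ≡⟨ cong (fullSum n h xor_) (fullSum-cong n (λ x p → cong₂ _∧_ (anti′ _ (s≤s z≤n))
          (chainParity-neg s′ anti′ n _ (cong suc p)))) ⟩
  fullSum n h xor fullSum n (λ x → not (s′ (just true ∷ x)) ∧ chainParity s′ n (just true ∷ x))
    ≡⟨ fullSum-xor n _ _ ⟨
  fullSum n (λ x → h x xor (not (s′ (just true ∷ x)) ∧ chainParity s′ n (just true ∷ x)))
    ≡⟨ fullSum-cong n (λ x _ → split-∧ (s′ (just true ∷ x)) _) ⟩
  fullSum n (λ x → chainParity s′ n (just true ∷ x))
    ≡⟨ hemisphere n s′ anti′ ⟩
  true ∎
  where
  open ≡-Reasoning
  g : SV (2 + n) → Bool
  g y = s y ∧ chainParity s n y
  s′ : SV (suc n) → Bool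
  s′ x = s (nothing ∷ x)
  anti′ : Antipodal s′
  anti′ x p = anti (nothing ∷ x) p
  h : SV n → Bool
  h x = s′ (just true ∷ x) ∧ chainParity s′ n (just true ∷ x)

-- Popular colours

positive : ∀ {n} → SV n → Subset n
positive [] = []
positive (just true ∷ x) = true ∷ positive x
positive (just false ∷ x) = false ∷ positive x
positive (nothing ∷ x) = false ∷ positive x

negative : ∀ {n} → SV n → Subset n
negative x = positive (neg x)

_⊆ᵇ_ : ∀ {n} → Subset n → Subset n → Bool
[] ⊆ᵇ [] = true
(true ∷ p) ⊆ᵇ (b ∷ q) = b ∧ (p ⊆ᵇ q)
(false ∷ p) ⊆ᵇ (b ∷ q) = p ⊆ᵇ q

⊆ᵇ-refl : ∀ {n} (p : Subset n) → p ⊆ᵇ p ≡ true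
⊆ᵇ-refl [] = refl
⊆ᵇ-refl (true ∷ p) = ⊆ᵇ-refl p
⊆ᵇ-refl (false ∷ p) = ⊆ᵇ-refl p

positive-⋖ : ∀ {n} {y x : SV n} → y ⋖ x → positive y ⊆ᵇ positive x ≡ true
positive-⋖ (drop {b = true} {x}) = ⊆ᵇ-refl (positive x)
positive-⋖ (drop {b = false} {x}) = ⊆ᵇ-refl (positive x)
positive-⋖ (keep {a = just true} p) = positive-⋖ p
positive-⋖ (keep {a = just false} p) = positive-⋖ p
positive-⋖ (keep {a = nothing} p) = positive-⋖ p

neg-⋖ : ∀ {n} {y x : SV n} → y ⋖ x → neg y ⋖ neg x
neg-⋖ drop = drop
neg-⋖ (keep p) = keep (neg-⋖ p)

neg-neg : ∀ {n} (x : SV n) → neg (neg x) ≡ x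
neg-neg [] = refl
neg-neg (nothing ∷ x) = cong (nothing ∷_) (neg-neg x)
neg-neg (just b ∷ x) = cong₂ _∷_ (cong just (not-involutive b)) (neg-neg x)

size-positive+negative : ∀ {n} (x : SV n) → ∣ positive x ∣ + ∣ negative x ∣ ≡ size x
size-positive+negative [] = refl
size-positive+negative (nothing ∷ x) = size-positive+negative x
size-positive+negative (just true ∷ x) = cong suc (size-positive+negative x)
size-positive+negative (just false ∷ x) =
  trans (+-suc ∣ positive x ∣ ∣ negative x ∣) (cong suc (size-positive+negative x))

-- An arbitrary antipodal function, which supplies the sign of vectors on which no colour is
-- popular.
leadingSign : ∀ {n} → SV n → Bool
leadingSign [] = true
leadingSign (nothing ∷ x) = leadingSign x
leadingSign (just b ∷ x) = b

leadingSign-antipodal : ∀ {n} → Antipodal (leadingSign {n})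
leadingSign-antipodal (nothing ∷ x) p = leadingSign-antipodal x p
leadingSign-antipodal (just b ∷ x) p = refl

-- The least i < m with q i, or m if there is none.
least : (ℕ → Bool) → ℕ → ℕ
least q zero = zero
least q (suc m) = if q zero then zero else suc (least (q ∘ suc) m)

least-cong : ∀ {q q′} → (∀ i → q i ≡ q′ i) → ∀ m → least q m ≡ least q′ m
least-cong e zero = refl
least-cong e (suc m) rewrite e zero | least-cong (e ∘ suc) m = refl

least-≤ : ∀ q m i → i < m → q i ≡ true → least q m ≤ i
least-≤ q (suc m) zero i<m e rewrite e = z≤n
least-≤ q (suc m) (suc i) (s≤s i<m) e with q zero
... | true = z≤n
... | false = s≤s (least-≤ (q ∘ suc) m i i<m e)

least-holds : ∀ q m → least q m < m → q (least q m) ≡ true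
least-holds q (suc m) l<m with q zero in eq
... | true = eq
least-holds q (suc m) (s≤s l<m) | false = least-holds (q ∘ suc) m l<m

∨-true : ∀ {a b} → a ∨ b ≡ true → a ≡ true ⊎ b ≡ true
∨-true {true} e = inj₁ refl
∨-true {false} e = inj₂ e

-- The sign of x tells on which side of x its least popular colour lives. Along an alternating
-- chain the least popular colour therefore strictly decreases once it exists.
module _ {n m k : ℕ} (popular : ℕ → Subset (suc n) → Bool)
  (popular-mono : ∀ i p q → p ⊆ᵇ q ≡ true → popular i p ≡ true → popular i q ≡ true)
  (popular-exists : ∀ p → k ≤ ∣ p ∣ → ∃[ i ] (i < m × popular i p ≡ true))
  (not-both : ∀ i x → popular i (positive x) ≡ true → popular i (negative x) ≡ true → ⊥) where

  private
    colours : SV (suc n) → ℕ → Bool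
    colours x i = popular i (positive x) ∨ popular i (negative x)

    leastColour : SV (suc n) → ℕ
    leastColour x = least (colours x) m

    -- The colour is a separate argument so that the signs of two vectors can be compared at a
    -- common colour.
    signWith : SV (suc n) → ℕ → Bool
    signWith x l with l <? m
    ... | yes _ = popular l (positive x)
    ... | no _ = leadingSign x

    sign : SV (suc n) → Bool
    sign x = signWith x (leastColour x)

    leastColour-neg : ∀ x → leastColour (neg x) ≡ leastColour x
    leastColour-neg x = least-cong (λ i → trans
      (cong (λ z → popular i (negative x) ∨ popular i (positive z)) (neg-neg x))
      (∨-comm (popular i (negative x)) _)) m

    exactly-one : ∀ x i → colours x i ≡ true → popular i (negative x) ≡ not (popular i (positive x))
    exactly-one x i e with popular i (positive x) in e₁ | popular i (negative x) in e₂
    ... | true | true = ⊥-elim (not-both i x e₁ e₂)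
    ... | true | false = refl
    ... | false | true = refl

    signWith-neg : ∀ x l → (l < m → colours x l ≡ true) → 0 < size x → signWith (neg x) l ≡ not (signWith x l)
    signWith-neg x l h p with l <? m
    ... | yes l<m = exactly-one x l (h l<m)
    ... | no _ = leadingSign-antipodal x p

    sign-antipodal : Antipodal sign
    sign-antipodal x p = trans (cong (signWith (neg x)) (leastColour-neg x))
      (signWith-neg x (leastColour x) (least-holds (colours x) m) p)

    colours-mono : ∀ {y x} i → y ⋖ x → colours y i ≡ true → colours x i ≡ true
    colours-mono {y} {x} i p e with ∨-true {popular i (positive y)} e
    ... | inj₁ a rewrite popular-mono i _ _ (positive-⋖ p) a = refl
    ... | inj₂ b rewrite popular-mono i _ _ (positive-⋖ (neg-⋖ p)) b = ∨-zeroʳ _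

    -- Both sides only grow from y to x. A colour popular on the negative side of y stays so in x,
    -- and then `not-both` keeps it from being popular on the positive side.
    popular-stable : ∀ {y x} i → y ⋖ x → colours y i ≡ true →
      popular i (positive y) ≡ popular i (positive x)
    popular-stable {y} {x} i p e with popular i (positive y) in eq
    ... | true = sym (popular-mono i _ _ (positive-⋖ p) eq)
    ... | false with popular i (positive x) in eq′
    ...   | false = refl
    ...   | true = ⊥-elim (not-both i x eq′ (popular-mono i _ _ (positive-⋖ (neg-⋖ p)) e))

    signWith-stable : ∀ {y x} l → y ⋖ x → l < m → colours y l ≡ true → signWith y l ≡ signWith x l
    signWith-stable l p l<m e with l <? m
    ... | yes _ = popular-stable l p e
    ... | no ¬l<m = ⊥-elim (¬l<m l<m)

    -- The least colour of y is still popular in x, so the least colour cannot go up; if it stayed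
    -- the same, the signs would agree.
    leastColour-decreases : ∀ {y x} → y ⋖ x → leastColour y < m → sign y ≢ sign x → leastColour x < leastColour y
    leastColour-decreases {y} {x} p l<m ne =
      ≤∧≢⇒< (least-≤ (colours x) m _ l<m (colours-mono {y} {x} _ p holds))
            (λ eq → ne (trans (signWith-stable (leastColour y) p l<m holds) (cong (signWith x) (sym eq))))
      where holds = least-holds (colours y) m l<m

    -- With at least 2 k - 1 nonzero entries, one side has at least k of them.
    leastColour-exists : ∀ x → k + k ≤ suc (size x) → leastColour x < m
    leastColour-exists x big with k ≤? ∣ positive x ∣
    ... | yes a with i , i<m , e ← popular-exists _ a =
      ≤-<-trans (least-≤ (colours x) m i i<m (cong (_∨ popular i (negative x)) e)) i<m
    ... | no ¬a with k ≤? ∣ negative x ∣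
    ...   | yes b with i , i<m , e ← popular-exists _ b =
      ≤-<-trans (least-≤ (colours x) m i i<m (trans (cong (popular i (positive x) ∨_) e) (∨-zeroʳ _))) i<m
    ...   | no ¬b = ⊥-elim (<-irrefl refl (begin-strict
      suc (size x)                                    ≡⟨ cong suc (size-positive+negative x) ⟨
      suc (∣ positive x ∣ + ∣ negative x ∣)            <⟨ s≤s (≤-reflexive (sym (+-suc _ _))) ⟩
      suc ∣ positive x ∣ + suc ∣ negative x ∣          ≤⟨ +-mono-≤ (≰⇒> ¬a) (≰⇒> ¬b) ⟩
      k + k                                           ≤⟨ big ⟩
      suc (size x)                                    ∎))
      where open ≤-Reasoning

    -- Along an alternating chain ending at x, j steps lead down to size i + 1 ≥ 2 k - 1, where
    -- `leastColour-exists` still applies; each of them raises the least colour by at least one.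
    leastColour-bound : ∀ i j x → size x ≡ suc (i + j) → k + k ≤ suc (suc i) → chainParity sign (i + j) x ≡ true →
      leastColour x + j < m
    leastColour-bound i zero x p big c rewrite +-identityʳ i | +-identityʳ (leastColour x) =
      leastColour-exists x (subst (λ z → k + k ≤ suc z) (sym p) big)
    leastColour-bound i (suc j) x p big c rewrite +-suc i j
      with y , q , sy , cy ← alternating-step sign (i + j) x p c (not (sign x)) = begin-strict
        leastColour x + suc j   ≡⟨ +-suc _ j ⟩
        suc (leastColour x) + j ≤⟨ +-monoˡ-≤ j (leastColour-decreases q (m+n≤o⇒m≤o _ bound) ne) ⟩
        leastColour y + j       <⟨ bound ⟩
        m                       ∎
      where
      open ≤-Reasoning
      bound = leastColour-bound i j y (suc-injective (trans (sym (⋖-size q)) p)) big cy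
      ne : sign y ≢ sign x
      ne e with sign x | trans (sym sy) e
      ... | true | ()
      ... | false | ()

  few-colours-collide : 1 ≤ k → m + (k + k) ≤ 2 + n → ⊥
  few-colours-collide 1≤k few with x , p , c ← fullSum-true n _ (hemisphere n sign sign-antipodal) =
    <-irrefl refl (begin-strict
      m                    ≤⟨ m≤n+m m _ ⟩
      leastColour v + m    ≤⟨ +-monoʳ-≤ (leastColour v) m≤j ⟩
      leastColour v + j    <⟨ leastColour-bound i j v (cong suc (trans p (sym i+j≡n))) (≤-reflexive k+k≡2+i)
                                (subst (λ z → chainParity sign z v ≡ true) (sym i+j≡n) c) ⟩
      m                    ∎)
    where
    open ≤-Reasoning
    v = just true ∷ x
    -- The size i + 1 = 2 k - 1 is the smallest at which a colour must be popular on some side, and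
    -- j steps lead from there to a full vector of size n + 1.
    i = k + k ∸ 2
    j = n ∸ i
    k+k≡2+i : k + k ≡ 2 + i
    k+k≡2+i = sym (m+[n∸m]≡n (+-mono-≤ 1≤k 1≤k))
    m+i≤n : m + i ≤ n
    m+i≤n = +-cancelˡ-≤ 2 _ _ (subst (_≤ 2 + n)
      (trans (cong (m +_) k+k≡2+i) (trans (+-suc m (suc i)) (cong suc (+-suc m i)))) few)
    i+j≡n : i + j ≡ n
    i+j≡n = m+[n∸m]≡n (m+n≤o⇒n≤o m m+i≤n)
    m≤j : m ≤ j
    m≤j = m+n≤o⇒m≤o∸n m m+i≤n

-- Tournaments without large dominance

length-cartesianProductWith : ∀ {A B C : Set} (f : A → B → C) xs ys →
  length (cartesianProductWith f xs ys) ≡ length xs * length ys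
length-cartesianProductWith f [] ys = refl
length-cartesianProductWith f (x ∷ xs) ys =
  trans (length-++ (List.map (f x) ys))
        (cong₂ _+_ (length-map (f x) ys) (length-cartesianProductWith f xs ys))

unique-map : ∀ {A B : Set} (f : A → B) {xs} → (∀ {x y} → x ∈ xs → y ∈ xs → f x ≡ f y → x ≡ y) →
  Unique xs → Unique (List.map f xs)
unique-map f inj [] = []
unique-map f inj (x≢ ∷ u) =
  All.map⁺ (All.tabulate (λ y∈ e → All.lookup x≢ y∈ (inj (here refl) (there y∈) e)))
  ∷ unique-map f (λ p q → inj (there p) (there q)) u

-- just b prescribes the value b of a bit, nothing leaves it free.
Pattern : ℕ → Set
Pattern E = Vec (Maybe Bool) E

free : ∀ {E} → Pattern E → ℕ
free [] = 0
free (nothing ∷ p) = suc (free p)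
free (just _ ∷ p) = free p

Violates : ∀ {E} → Vec Bool E → Pattern E → Set
Violates β p = ∃[ i ] ∃[ b ] (lookup p i ≡ just b × lookup β i ≡ not b)

-- A pattern p is obeyed by `2 ^ free p` vectors, so this counts the obeying vectors with
-- multiplicity, as in a union bound.
matching : ∀ {E} → List (Pattern E) → ℕ
matching [] = 0
matching (p ∷ ps) = 2 ^ free p + matching ps

restrict : ∀ {E} → Bool → List (Pattern (suc E)) → List (Pattern E)
restrict b [] = []
restrict b ((nothing ∷ p) ∷ ps) = p ∷ restrict b ps
restrict true ((just true ∷ p) ∷ ps) = p ∷ restrict true ps
restrict true ((just false ∷ p) ∷ ps) = restrict true ps
restrict false ((just true ∷ p) ∷ ps) = restrict false ps
restrict false ((just false ∷ p) ∷ ps) = p ∷ restrict false ps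

matching-restrict : ∀ {E} (ps : List (Pattern (suc E))) →
  matching ps ≡ matching (restrict true ps) + matching (restrict false ps)
matching-restrict [] = refl
matching-restrict ((nothing ∷ p) ∷ ps) = begin
  2 * 2 ^ free p + matching ps ≡⟨ cong₂ _+_ (cong (2 ^ free p +_) (+-identityʳ _)) (matching-restrict ps) ⟩
  (2 ^ free p + 2 ^ free p) + (matching (restrict true ps) + matching (restrict false ps))
    ≡⟨ interchange +-commutativeSemigroup (2 ^ free p) _ _ _ ⟩
  (2 ^ free p + matching (restrict true ps)) + (2 ^ free p + matching (restrict false ps)) ∎
  where
  open ≡-Reasoning
matching-restrict ((just true ∷ p) ∷ ps) =
  trans (cong (2 ^ free p +_) (matching-restrict ps)) (sym (+-assoc (2 ^ free p) _ _))
matching-restrict ((just false ∷ p) ∷ ps) = begin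
  2 ^ free p + matching ps ≡⟨ cong (2 ^ free p +_) (matching-restrict ps) ⟩
  2 ^ free p + (t + f)     ≡⟨ +-assoc (2 ^ free p) t f ⟨
  (2 ^ free p + t) + f     ≡⟨ cong (_+ f) (+-comm (2 ^ free p) t) ⟩
  (t + 2 ^ free p) + f     ≡⟨ +-assoc t (2 ^ free p) f ⟩
  t + (2 ^ free p + f)     ∎
  where
  open ≡-Reasoning
  t = matching (restrict true ps)
  f = matching (restrict false ps)

restrict-violates : ∀ {E} b {β : Vec Bool E} ps → All (Violates β) (restrict b ps) → All (Violates (b ∷ β)) ps
restrict-violates b [] v = []
restrict-violates b ((nothing ∷ p) ∷ ps) ((i , w) ∷ v) = (fsuc i , w) ∷ restrict-violates b ps v
restrict-violates true ((just true ∷ p) ∷ ps) ((i , w) ∷ v) = (fsuc i , w) ∷ restrict-violates true ps v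
restrict-violates true ((just false ∷ p) ∷ ps) v = (fzero , false , refl , refl) ∷ restrict-violates true ps v
restrict-violates false ((just true ∷ p) ∷ ps) v = (fzero , true , refl , refl) ∷ restrict-violates false ps v
restrict-violates false ((just false ∷ p) ∷ ps) ((i , w) ∷ v) = (fsuc i , w) ∷ restrict-violates false ps v

-- The union bound, carried out bit by bit as in the method of conditional expectations: for one of
-- the two values of the next bit, the matches stay fewer than the remaining vectors.
violating-vector : ∀ E (ps : List (Pattern E)) → matching ps < 2 ^ E → ∃[ β ] All (Violates β) ps
violating-vector zero [] h = [] , []
violating-vector zero ([] ∷ ps) (s≤s ())
violating-vector (suc E) ps h with matching (restrict true ps) <? 2 ^ E
... | yes a with β , v ← violating-vector E (restrict true ps) a = true ∷ β , restrict-violates true ps v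
... | no ¬a with matching (restrict false ps) <? 2 ^ E
...   | yes b with β , v ← violating-vector E (restrict false ps) b = false ∷ β , restrict-violates false ps v
...   | no ¬b = ⊥-elim (<⇒≱ h (begin
  2 ^ E + (2 ^ E + 0) ≡⟨ cong (2 ^ E +_) (+-identityʳ _) ⟩
  2 ^ E + 2 ^ E       ≤⟨ +-mono-≤ (≮⇒≥ ¬a) (≮⇒≥ ¬b) ⟩
  matching (restrict true ps) + matching (restrict false ps) ≡⟨ matching-restrict ps ⟨
  matching ps ∎))
  where open ≤-Reasoning

-- Patterns prescribing at least w bits are each obeyed by at most a fraction 1 / 2 ^ w of the
-- vectors; the factor `2 ^ w` avoids division.
matching-bound : ∀ {E w} {ps : List (Pattern E)} → All (λ p → free p + w ≤ E) ps → matching ps * 2 ^ w ≤ length ps * 2 ^ E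
matching-bound [] = z≤n
matching-bound {E} {w} {p ∷ ps} (h ∷ hs) = begin
  (2 ^ free p + matching ps) * 2 ^ w        ≡⟨ *-distribʳ-+ (2 ^ w) (2 ^ free p) _ ⟩
  2 ^ free p * 2 ^ w + matching ps * 2 ^ w  ≡⟨ cong (_+ matching ps * 2 ^ w) (^-distribˡ-+-* 2 (free p) w) ⟨
  2 ^ (free p + w) + matching ps * 2 ^ w    ≤⟨ +-mono-≤ (^-monoʳ-≤ 2 h) (matching-bound hs) ⟩
  2 ^ E + length ps * 2 ^ E                 ∎
  where open ≤-Reasoning

few-wide-patterns : ∀ {E} w (ps : List (Pattern E)) → All (λ p → free p + w ≤ E) ps → length ps < 2 ^ w →
  ∃[ β ] All (Violates β) ps
few-wide-patterns {E} w ps wide few = violating-vector E ps (*-cancelʳ-< (2 ^ w) _ _ (begin-strict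
  matching ps * 2 ^ w  ≤⟨ matching-bound wide ⟩
  length ps * 2 ^ E    <⟨ *-monoˡ-< (2 ^ E) {{m^n≢0 2 E}} few ⟩
  2 ^ w * 2 ^ E        ≡⟨ *-comm (2 ^ w) (2 ^ E) ⟩
  2 ^ E * 2 ^ w        ∎))
  where open ≤-Reasoning

prescribe : ∀ {E} → List (Fin E × Bool) → Pattern E
prescribe [] = replicate _ nothing
prescribe ((i , b) ∷ ls) = prescribe ls [ i ]≔ just b

free-replicate : ∀ E → free (replicate E nothing) ≡ E
free-replicate zero = refl
free-replicate (suc E) = cong suc (free-replicate E)

free-update : ∀ {E} (p : Pattern E) i b → lookup p i ≡ nothing → suc (free (p [ i ]≔ just b)) ≡ free p
free-update (nothing ∷ p) fzero b e = refl
free-update (nothing ∷ p) (fsuc i) b e = cong suc (free-update p i b e)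
free-update (just _ ∷ p) (fsuc i) b e = free-update p i b e

prescribe-nothing : ∀ {E} (ls : List (Fin E × Bool)) {i} → All (λ l → i ≢ proj₁ l) ls → lookup (prescribe ls) i ≡ nothing
prescribe-nothing [] {i} h = lookup-replicate i nothing
prescribe-nothing ((j , b) ∷ ls) (i≢j ∷ h) = trans (lookup∘update′ i≢j (prescribe ls) _) (prescribe-nothing ls h)

prescribe-just : ∀ {E} (ls : List (Fin E × Bool)) {i b} → lookup (prescribe ls) i ≡ just b → (i , b) ∈ ls
prescribe-just [] {i} e with trans (sym (lookup-replicate i nothing)) e
... | ()
prescribe-just ((j , c) ∷ ls) {i} e with i Fin.≟ j
... | yes refl = here (cong (i ,_) (just-injective (trans (sym e) (lookup∘update i (prescribe ls) (just c)))))
... | no i≢j = there (prescribe-just ls (trans (sym (lookup∘update′ i≢j (prescribe ls) _)) e))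

free-prescribe : ∀ {E} (ls : List (Fin E × Bool)) → Unique (List.map proj₁ ls) → free (prescribe ls) + length ls ≡ E
free-prescribe {E} [] u = trans (+-identityʳ _) (free-replicate E)
free-prescribe ((i , b) ∷ ls) (h ∷ u) =
  trans (+-suc _ (length ls))
  (trans (cong (_+ length ls) (free-update (prescribe ls) i b (prescribe-nothing ls (All.map⁻ h))))
         (free-prescribe ls u))

words : ∀ M → ℕ → List (List (Fin M))
words M zero = [] ∷ []
words M (suc r) = cartesianProductWith _∷_ (allFin M) (words M r)

length-words : ∀ M r → length (words M r) ≡ M ^ r
length-words M zero = refl
length-words M (suc r) = trans (length-cartesianProductWith _∷_ (allFin M) (words M r))
  (cong₂ _*_ (length-tabulate {n = M} (λ i → i)) (length-words M r))

∈-words : ∀ {M} (xs : List (Fin M)) → xs ∈ words M (length xs)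
∈-words [] = here refl
∈-words (x ∷ xs) = ∈-cartesianProductWith⁺ _∷_ (∈-allFin x) (∈-words xs)

module _ {M : ℕ} where

  -- The bit deciding the pair {u , v}, and whether it has to be negated to be read as u → v.
  edge : Fin M → Fin M → Fin (M * M) × Bool
  edge u v with toℕ u <? toℕ v
  ... | yes _ = combine u v , false
  ... | no _ = combine v u , true

  edge-swap : ∀ {u v} → u ≢ v → proj₁ (edge v u) ≡ proj₁ (edge u v) × proj₂ (edge v u) ≡ not (proj₂ (edge u v))
  edge-swap {u} {v} u≢v with toℕ u <? toℕ v | toℕ v <? toℕ u
  ... | yes u<v | yes v<u = ⊥-elim (<-asym u<v v<u)
  ... | yes _ | no _ = refl , refl
  ... | no _ | yes _ = refl , refl
  ... | no u≮v | no v≮u = ⊥-elim (u≢v (toℕ-injective (≤-antisym (≮⇒≥ v≮u) (≮⇒≥ u≮v))))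

  edge-injective : ∀ {u v u′ v′} → proj₁ (edge u v) ≡ proj₁ (edge u′ v′) →
    (u ≡ u′ × v ≡ v′) ⊎ (u ≡ v′ × v ≡ u′)
  edge-injective {u} {v} {u′} {v′} e with toℕ u <? toℕ v | toℕ u′ <? toℕ v′
  ... | yes _ | yes _ = inj₁ (combine-injective u v u′ v′ e)
  ... | yes _ | no _ = inj₂ (combine-injective u v v′ u′ e)
  ... | no _ | yes _ with a , b ← combine-injective v u u′ v′ e = inj₂ (b , a)
  ... | no _ | no _ with a , b ← combine-injective v u v′ u′ e = inj₁ (b , a)

  -- These bits express that each u beats each v: the bit, once corrected by the flag of `edge`, has
  -- to be true, so it is the negated flag.
  dominance : List (Fin M) → List (Fin M) → List (Fin (M * M) × Bool)
  dominance us vs = List.map (λ (u , v) → proj₁ (edge u v) , not (proj₂ (edge u v))) (cartesianProduct us vs)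

  length-dominance : ∀ us vs → length (dominance us vs) ≡ length us * length vs
  length-dominance us vs = trans (length-map _ (cartesianProduct us vs)) (length-cartesianProductWith _,_ us vs)

  -- Two ordered pairs share a bit only if they are equal or reversed, and disjointness excludes
  -- reversed pairs.
  unique-dominance : ∀ {us vs} → Unique us → Unique vs → (∀ {u} → u ∈ us → u ∉ vs) →
    Unique (List.map proj₁ (dominance us vs))
  unique-dominance {us} {vs} uu uv disjoint =
    subst Unique (map-∘ (cartesianProduct us vs))
      (unique-map (λ (u , v) → proj₁ (edge u v)) inj (Unique.cartesianProduct⁺ uu uv))
    where
    inj : ∀ {x y} → x ∈ cartesianProduct us vs → y ∈ cartesianProduct us vs →
      proj₁ (edge (proj₁ x) (proj₂ x)) ≡ proj₁ (edge (proj₁ y) (proj₂ y)) → x ≡ y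
    inj {u , v} {u′ , v′} x∈ y∈ e with edge-injective {u} {v} {u′} {v′} e
    ... | inj₁ (refl , refl) = refl
    ... | inj₂ (refl , refl) = ⊥-elim (disjoint (proj₁ (∈-cartesianProduct⁻ us vs x∈)) (proj₂ (∈-cartesianProduct⁻ us vs y∈)))

record Tournament (M r : ℕ) : Set where
  field
    beats : Fin M → Fin M → Bool
    beats-swap : ∀ {u v} → u ≢ v → beats v u ≡ not (beats u v)
    no-dominance : ∀ us vs → length us ≡ r → length vs ≡ r → Unique us → Unique vs →
      (∀ {u} → u ∈ us → u ∉ vs) → ¬ (∀ {u v} → u ∈ us → v ∈ vs → beats u v ≡ true)

-- There are at most M ^ (2 r) ≤ 2 ^ (2 ℓ r) pairs (us , vs), and each prescribes r ^ 2 > 2 ℓ r bits.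
tournament : ∀ {M ℓ r} → M ≤ 2 ^ ℓ → 2 * ℓ < r → Tournament M r
tournament {M} {ℓ} {r} M≤ 2ℓ<r = record
  { beats = beats
  ; beats-swap = λ {u} {v} u≢v → beats-swap u≢v
  ; no-dominance = no-dominance
  }
  where
  pairs = cartesianProduct (words M r) (words M r)
  -- Words with repeated or common vertices may prescribe fewer than r * r bits. Such patterns are
  -- filtered out; `no-dominance` concerns only distinct and disjoint vertices, whose patterns
  -- remain.
  wide? = λ (p : Pattern (M * M)) → free p + r * r ≤? M * M
  pattern-of = λ ((us , vs) : List (Fin M) × List (Fin M)) → prescribe (dominance us vs)
  patterns = filter wide? (List.map pattern-of pairs)

  few : length patterns < 2 ^ (r * r)
  few = begin-strict
    length patterns              ≤⟨ length-filter wide? (List.map pattern-of pairs) ⟩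
    length (List.map pattern-of pairs) ≡⟨ length-map pattern-of pairs ⟩
    length pairs                 ≡⟨ length-cartesianProductWith _,_ (words M r) (words M r) ⟩
    length (words M r) * length (words M r) ≡⟨ cong₂ _*_ (length-words M r) (length-words M r) ⟩
    M ^ r * M ^ r                ≤⟨ *-mono-≤ (^-monoˡ-≤ r M≤) (^-monoˡ-≤ r M≤) ⟩
    (2 ^ ℓ) ^ r * (2 ^ ℓ) ^ r    ≡⟨ cong₂ _*_ (^-*-assoc 2 ℓ r) (^-*-assoc 2 ℓ r) ⟩
    2 ^ (ℓ * r) * 2 ^ (ℓ * r)    ≡⟨ ^-distribˡ-+-* 2 (ℓ * r) (ℓ * r) ⟨
    2 ^ (ℓ * r + ℓ * r)          ≡⟨ cong (2 ^_) (*-distribʳ-+ r ℓ ℓ) ⟨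
    2 ^ ((ℓ + ℓ) * r)            ≡⟨ cong (λ z → 2 ^ ((ℓ + z) * r)) (+-identityʳ ℓ) ⟨
    2 ^ (2 * ℓ * r)              <⟨ ^-monoʳ-< 2 (s≤s (s≤s z≤n)) (*-monoˡ-< r {{>-nonZero (≤-<-trans z≤n 2ℓ<r)}} 2ℓ<r) ⟩
    2 ^ (r * r)                  ∎
    where
    open ≤-Reasoning

  solution = few-wide-patterns (r * r) patterns (All.all-filter wide? (List.map pattern-of pairs)) few
  β = proj₁ solution

  beats : Fin M → Fin M → Bool
  beats u v = lookup β (proj₁ (edge u v)) xor proj₂ (edge u v)

  xor-not : ∀ a b → a xor not b ≡ not (a xor b)
  xor-not true b = refl
  xor-not false b = refl

  beats-swap : ∀ {u v} → u ≢ v → beats v u ≡ not (beats u v)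
  beats-swap {u} {v} u≢v with e , f ← edge-swap u≢v rewrite e | f = xor-not (lookup β _) _

  no-dominance : ∀ us vs → length us ≡ r → length vs ≡ r → Unique us → Unique vs →
    (∀ {u} → u ∈ us → u ∉ vs) → ¬ (∀ {u v} → u ∈ us → v ∈ vs → beats u v ≡ true)
  no-dominance us vs lu lv uu uv disjoint dom = contra violated
    where
    word : ∀ xs → length xs ≡ r → xs ∈ words M r
    word xs l = subst (λ z → xs ∈ words M z) l (∈-words xs)
    isWide : free (prescribe (dominance us vs)) + r * r ≤ M * M
    isWide = ≤-reflexive (trans
      (cong (free (prescribe (dominance us vs)) +_) (sym (trans (length-dominance us vs) (cong₂ _*_ lu lv))))
      (free-prescribe (dominance us vs) (unique-dominance uu uv disjoint)))
    violated : Violates β (prescribe (dominance us vs))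
    violated = All.lookup (proj₂ solution)
      (∈-filter⁺ wide? (∈-map⁺ pattern-of (∈-cartesianProduct⁺ (word us lu) (word vs lv))) isWide)
    contra : Violates β (prescribe (dominance us vs)) → ⊥
    -- The violated bit belongs to some pair u, v and equals its flag, so `beats u v` is false.
    contra (i , b , e , e′) with (u , v) , uv∈ , refl ← ∈-map⁻ _ (prescribe-just (dominance us vs) e)
      with u∈ , v∈ ← ∈-cartesianProduct⁻ us vs uv∈
      with () ← trans (sym (dom u∈ v∈)) (trans (cong (_xor proj₂ (edge u v)) (trans e′ (not-involutive _)))
             (xor-same (proj₂ (edge u v))))

-- Counting, and nested neighbourhoods

≤⇒≤ᵇ≡true : ∀ {a b} → a ≤ b → (a ≤ᵇ b) ≡ true
≤⇒≤ᵇ≡true p = Equivalence.to T-≡ (≤⇒≤ᵇ p)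

≤ᵇ≡true⇒≤ : ∀ {a b} → (a ≤ᵇ b) ≡ true → a ≤ b
≤ᵇ≡true⇒≤ {a} p = ≤ᵇ⇒≤ a _ (Equivalence.from T-≡ p)

count : ∀ {A : Set} → (A → Bool) → List A → ℕ
count p xs = length (filterᵇ p xs)

module _ {A : Set} where

  count-++ : ∀ (p : A → Bool) xs ys → count p (xs ++ ys) ≡ count p xs + count p ys
  count-++ p [] ys = refl
  count-++ p (x ∷ xs) ys with p x
  ... | true = cong suc (count-++ p xs ys)
  ... | false = count-++ p xs ys

  count-map : ∀ {B : Set} (p : A → Bool) (f : B → A) xs → count p (List.map f xs) ≡ count (p ∘ f) xs
  count-map p f [] = refl
  count-map p f (x ∷ xs) with p (f x)
  ... | true = cong suc (count-map p f xs)
  ... | false = count-map p f xs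

  count-⊎ : ∀ (p q r : A → Bool) → (∀ x → p x ≡ true → q x ≡ true ⊎ r x ≡ true) →
    ∀ xs → count p xs ≤ count q xs + count r xs
  count-⊎ p q r h [] = z≤n
  count-⊎ p q r h (x ∷ xs) with ih ← count-⊎ p q r h xs | p x | q x | r x | h x
  ... | false | true  | true  | _ = m≤n⇒m≤1+n (≤-trans ih (+-monoʳ-≤ _ (n≤1+n _)))
  ... | false | true  | false | _ = m≤n⇒m≤1+n ih
  ... | false | false | true  | _ = ≤-trans ih (+-monoʳ-≤ _ (n≤1+n _))
  ... | false | false | false | _ = ih
  ... | true  | true  | true  | _ = s≤s (≤-trans ih (+-monoʳ-≤ _ (n≤1+n _)))
  ... | true  | true  | false | _ = s≤s ih
  ... | true  | false | true  | _ = ≤-trans (s≤s ih) (≤-reflexive (sym (+-suc _ _)))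
  ... | true  | false | false | g with g refl
  ...   | inj₁ ()
  ...   | inj₂ ()

  count-none : ∀ (p : A → Bool) → (∀ x → p x ≡ false) → ∀ xs → count p xs ≡ 0
  count-none p h [] = refl
  count-none p h (x ∷ xs) rewrite h x = count-none p h xs

  count-mono : ∀ (p q : A → Bool) → (∀ x → p x ≡ true → q x ≡ true) → ∀ xs → count p xs ≤ count q xs
  count-mono p q h xs = ≤-trans (count-⊎ p q (λ _ → false) (λ x e → inj₁ (h x e)) xs)
    (≤-reflexive (trans (cong (count q xs +_) (count-none _ (λ _ → refl) xs)) (+-identityʳ _)))

  count-all : ∀ (p : A → Bool) → (∀ x → p x ≡ true) → ∀ xs → count p xs ≡ length xs
  count-all p h [] = refl
  count-all p h (x ∷ xs) rewrite h x = cong suc (count-all p h xs)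

  length≤count+count-not : ∀ (p : A → Bool) xs → length xs ≤ count p xs + count (not ∘ p) xs
  length≤count+count-not p xs = subst (_≤ count p xs + count (not ∘ p) xs) (count-all (λ _ → true) (λ _ → refl) xs)
    (count-⊎ (λ _ → true) p (not ∘ p) (λ x _ → either (p x)) xs)
    where
    either : ∀ b → b ≡ true ⊎ not b ≡ true
    either true = inj₁ refl
    either false = inj₂ refl

  -- Pigeonhole: if the last class has fewer than N elements, removing it leaves more than m * N for
  -- the other m classes.
  popular-class : ∀ (p : A → Bool) (col : A → ℕ) N xs m → m * N < count (λ x → p x ∧ (col x <ᵇ m)) xs →
    ∃[ i ] (i < m × N ≤ count (λ x → p x ∧ (col x ≡ᵇ i)) xs)
  popular-class p col N xs zero h =
    ⊥-elim (<-irrefl (sym (count-none (λ x → p x ∧ (col x <ᵇ 0)) (λ x → ∧-zeroʳ (p x)) xs)) h)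
  popular-class p col N xs (suc m) h with N ≤? count (λ x → p x ∧ (col x ≡ᵇ m)) xs
  ... | yes big = m , ≤-refl , big
  ... | no ¬big = let i , i<m , big = popular-class p col N xs m rest in i , m≤n⇒m≤1+n i<m , big
    where
    open ≤-Reasoning
    split : ∀ x → p x ∧ (col x <ᵇ suc m) ≡ true → p x ∧ (col x ≡ᵇ m) ≡ true ⊎ p x ∧ (col x <ᵇ m) ≡ true
    split x e with p x
    ... | true with m≤n⇒m<n∨m≡n (≤-pred (<ᵇ⇒< (col x) (suc m) (Equivalence.from T-≡ e)))
    ...   | inj₁ lt = inj₂ (Equivalence.to T-≡ (<⇒<ᵇ lt))
    ...   | inj₂ eq = inj₁ (Equivalence.to T-≡ (≡⇒≡ᵇ (col x) m eq))
    rest : m * N < count (λ x → p x ∧ (col x <ᵇ m)) xs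
    rest = +-cancelˡ-< N _ _ (begin-strict
      suc m * N <⟨ h ⟩
      count (λ x → p x ∧ (col x <ᵇ suc m)) xs ≤⟨ count-⊎ _ _ _ split xs ⟩
      count (λ x → p x ∧ (col x ≡ᵇ m)) xs + count (λ x → p x ∧ (col x <ᵇ m)) xs ≤⟨ +-monoˡ-≤ _ (<⇒≤ (≰⇒> ¬big)) ⟩
      N + count (λ x → p x ∧ (col x <ᵇ m)) xs ∎)

  ∈-filterᵇ⁻ : ∀ (p : A → Bool) {xs x} → x ∈ filterᵇ p xs → x ∈ xs × p x ≡ true
  ∈-filterᵇ⁻ p {xs} x∈ with a , b ← ∈-filter⁻ (T? ∘ p) {xs = xs} x∈ = a , Equivalence.to T-≡ b

  record Chosen (r : ℕ) (P : A → Set) : Set where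
    constructor chosen
    field
      list : List A
      length≡ : length list ≡ r
      unique : Unique list
      satisfies : ∀ {x} → x ∈ list → P x

  choose : ∀ {r} (p : A → Bool) {xs} → Unique xs → r ≤ count p xs → Chosen r (λ x → x ∈ xs × p x ≡ true)
  choose {r} p {xs} u big = chosen (take r (filterᵇ p xs))
    (trans (length-take r (filterᵇ p xs)) (m≤n⇒m⊓n≡m big))
    (Unique.take⁺ r (Unique.filter⁺ (T? ∘ p) u))
    (All.lookup (All.take⁺ r (All.tabulate (∈-filterᵇ⁻ p))))

  minimum : (_≼_ : A → A → Set) → (∀ {x} → x ≼ x) → (∀ {x y z} → x ≼ y → y ≼ z → x ≼ z) →
    ∀ xs → 0 < length xs → (∀ {x y} → x ∈ xs → y ∈ xs → x ≼ y ⊎ y ≼ x) →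
    ∃[ x ] (x ∈ xs × (∀ {y} → y ∈ xs → x ≼ y))
  minimum _≼_ rf tr (x ∷ []) _ tot = x , here refl , λ { (here refl) → rf }
  minimum _≼_ rf tr (x ∷ xs@(_ ∷ _)) _ tot
    with z , z∈ , low ← minimum _≼_ rf tr xs (s≤s z≤n) (λ a b → tot (there a) (there b))
    with tot (here refl) (there z∈)
  ... | inj₁ x≼z = x , here refl , λ { (here refl) → rf ; (there y∈) → tr x≼z (low y∈) }
  ... | inj₂ z≼x = z , there z∈ , λ { (here refl) → z≼x ; (there y∈) → low y∈ }

  search : ∀ (p : A → Bool) xs → (∃[ x ] (x ∈ xs × p x ≡ true)) ⊎ (∀ {x} → x ∈ xs → p x ≡ false)
  search p [] = inj₂ λ ()
  search p (x ∷ xs) with p x in e | search p xs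
  ... | true | _ = inj₁ (x , here refl , e)
  ... | false | inj₁ (y , y∈ , f) = inj₁ (y , there y∈ , f)
  ... | false | inj₂ none = inj₂ λ { (here refl) → e ; (there y∈) → none y∈ }

  -- Without an alternating rectangle (a directed 4-cycle, when R is read as a bipartite tournament)
  -- the rows {y | R x y} are nested. Either r rows have at least r elements, and then so does
  -- their intersection, or r rows have fewer than r elements, and then so does their union.
  homogeneous : ∀ {r} (R : A → A → Bool) {xs ys} → 1 ≤ r → r + r ≤ length xs → r + r ≤ length ys →
    Unique xs → Unique ys →
    (∀ {x x′ y y′} → x ∈ xs → x′ ∈ xs → y ∈ ys → y′ ∈ ys →
      R x y ≡ true → R x′ y ≡ false → R x′ y′ ≡ true → R x y′ ≡ false → ⊥) →
    Σ (Chosen r (_∈ xs)) λ us → Σ (Chosen r (_∈ ys)) λ vs → ∃[ b ]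
      (∀ {x y} → x ∈ Chosen.list us → y ∈ Chosen.list vs → R x y ≡ b)
  homogeneous {r} R {xs} {ys} 1≤r bigx bigy ux uy norect = conclusion
    where
    open ≤-Reasoning
    _≼_ : A → A → Set
    x ≼ x′ = ∀ {y} → y ∈ ys → R x y ≡ true → R x′ y ≡ true

    imp : ∀ {a b} → a ∧ not b ≡ false → a ≡ true → b ≡ true
    imp {true} {true} e refl = refl

    total≼ : ∀ {x x′} → x ∈ xs → x′ ∈ xs → x ≼ x′ ⊎ x′ ≼ x
    total≼ {x} {x′} x∈ x′∈ with search (λ y → R x y ∧ not (R x′ y)) ys
    ... | inj₂ none = inj₁ (λ y∈ → imp (none y∈))
    ... | inj₁ (y , y∈ , e) with search (λ y → R x′ y ∧ not (R x y)) ys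
    ...   | inj₂ none = inj₂ (λ y∈ → imp (none y∈))
    ...   | inj₁ (y′ , y′∈ , e′) with a , b ← ∧-true {R x y} e | a′ , b′ ← ∧-true {R x′ y′} e′ =
      ⊥-elim (norect x∈ x′∈ y∈ y′∈ a (unnot b) a′ (unnot b′))
      where
      unnot : ∀ {b} → not b ≡ true → b ≡ false
      unnot {false} e = refl

    large : A → Bool
    large x = r ≤ᵇ count (R x) ys

    weaken : ∀ {P Q : A → Set} → (∀ {x} → P x → Q x) → Chosen r P → Chosen r Q
    weaken f (chosen l e u s) = chosen l e u (f ∘ s)

    complement-large : ∀ (p : A → Bool) zs → r + r ≤ length zs → count p zs < r → r ≤ count (not ∘ p) zs
    complement-large p zs big small = +-cancelˡ-≤ r _ _ (begin
      r + r                             ≤⟨ big ⟩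
      length zs                         ≤⟨ length≤count+count-not p zs ⟩
      count p zs + count (not ∘ p) zs   ≤⟨ +-monoˡ-≤ _ (<⇒≤ small) ⟩
      r + count (not ∘ p) zs            ∎)

    conclusion : Σ (Chosen r (_∈ xs)) λ us → Σ (Chosen r (_∈ ys)) λ vs → ∃[ b ]
      (∀ {x y} → x ∈ Chosen.list us → y ∈ Chosen.list vs → R x y ≡ b)
    conclusion with r ≤? count large xs
    ... | yes many
      with us ← choose large ux many
      with x₀ , x₀∈ , low ← minimum _≼_ (λ _ e → e) (λ f g y∈ e → g y∈ (f y∈ e)) (Chosen.list us)
             (subst (0 <_) (sym (Chosen.length≡ us)) 1≤r)
             (λ a b → total≼ (proj₁ (Chosen.satisfies us a)) (proj₁ (Chosen.satisfies us b)))
      with vs ← choose (R x₀) uy (≤ᵇ≡true⇒≤ {r} (proj₂ (Chosen.satisfies us x₀∈)))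
      = weaken proj₁ us , weaken proj₁ vs , true ,
        λ x∈ y∈ → let y∈ys , e = Chosen.satisfies vs y∈ in low x∈ y∈ys e
    ... | no ¬many
      with us ← choose (not ∘ large) ux (complement-large large xs bigx (≰⇒> ¬many))
      -- In the flipped order the minimum is the row containing all chosen rows, and at least r
      -- columns lie outside it.
      with x₀ , x₀∈ , high ← minimum (flip _≼_) (λ _ e → e) (λ f g y∈ e → f y∈ (g y∈ e)) (Chosen.list us)
             (subst (0 <_) (sym (Chosen.length≡ us)) 1≤r)
             (λ a b → total≼ (proj₁ (Chosen.satisfies us b)) (proj₁ (Chosen.satisfies us a)))
      with vs ← choose (not ∘ R x₀) uy (complement-large (R x₀) ys bigy (≰⇒> λ q →
             not-¬ (sym (≤⇒≤ᵇ≡true q)) (sym (proj₂ (Chosen.satisfies us x₀∈)))))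
      = weaken proj₁ us , weaken proj₁ vs , false ,
        λ x∈ y∈ → let y∈ys , e = Chosen.satisfies vs y∈ in ¬-not (λ t → not-¬ (sym (high x∈ y∈ys t)) (sym e))

-- Kneser graphs

drop-member : ∀ {n k} → V (KG n k) → V (KG (suc n) k)
drop-member (p , e) = false ∷ p , e

add-member : ∀ {n k} → V (KG n k) → V (KG (suc n) (suc k))
add-member (p , e) = true ∷ p , cong suc e

-- Separating `vertices-with` lets `vertices (suc n) k` unfold before it is known whether k is zero.
mutual
  vertices : ∀ n k → List (V (KG n k))
  vertices zero zero = ([] , refl) ∷ []
  vertices zero (suc k) = []
  vertices (suc n) k = List.map drop-member (vertices n k) ++ vertices-with n k

  vertices-with : ∀ n k → List (V (KG (suc n) k))
  vertices-with n zero = []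
  vertices-with n (suc k) = List.map add-member (vertices n k)

∈-vertices : ∀ {n k} (v : V (KG n k)) → v ∈ vertices n k
∈-vertices ([] , refl) = here refl
∈-vertices (true ∷ p , refl) = ∈-++⁺ʳ _ (∈-map⁺ add-member (∈-vertices (p , refl)))
∈-vertices (false ∷ p , e) = ∈-++⁺ˡ (∈-map⁺ drop-member (∈-vertices (p , e)))

vertex-≡ : ∀ {n k} {u v : V (KG n k)} → proj₁ u ≡ proj₁ v → u ≡ v
vertex-≡ {u = p , e} {v = .p , e′} refl = cong (p ,_) (≡-irrelevant e e′)

∷-tail : ∀ {n} {b c : Bool} {p q : Subset n} → _≡_ {A = Subset (suc n)} (b ∷ p) (c ∷ q) → p ≡ q
∷-tail refl = refl

unique-vertices : ∀ n k → Unique (vertices n k)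
unique-vertices zero zero = [] ∷ []
unique-vertices zero (suc k) = []
unique-vertices (suc n) zero =
  Unique.++⁺ (Unique.map⁺ (λ e → vertex-≡ (∷-tail (cong proj₁ e))) (unique-vertices n zero)) [] λ ()
unique-vertices (suc n) (suc k) = Unique.++⁺
  (Unique.map⁺ (λ e → vertex-≡ (∷-tail (cong proj₁ e))) (unique-vertices n (suc k)))
  (Unique.map⁺ (λ e → vertex-≡ (∷-tail (cong proj₁ e))) (unique-vertices n k))
  disjoint
  where
  disjoint : ∀ {v} → v ∈ List.map drop-member (vertices n (suc k)) × v ∈ List.map add-member (vertices n k) → ⊥
  disjoint (a , b) with _ , _ , refl ← ∈-map⁻ drop-member a with _ , _ , () ← ∈-map⁻ add-member b

length-vertices-zero : ∀ n → length (vertices n 0) ≡ 1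
length-vertices-zero zero = refl
length-vertices-zero (suc n) = trans (length-++ (List.map drop-member (vertices n 0)))
  (trans (+-identityʳ _) (trans (length-map drop-member (vertices n 0)) (length-vertices-zero n)))

length-vertices-suc : ∀ n k → length (vertices (suc n) (suc k)) ≡ length (vertices n (suc k)) + length (vertices n k)
length-vertices-suc n k = trans (length-++ (List.map drop-member (vertices n (suc k))))
  (cong₂ _+_ (length-map drop-member (vertices n (suc k))) (length-map add-member (vertices n k)))

length-vertices≤2^n : ∀ n k → length (vertices n k) ≤ 2 ^ n
length-vertices≤2^n zero zero = ≤-refl
length-vertices≤2^n zero (suc k) = z≤n
length-vertices≤2^n (suc n) zero = subst (_≤ 2 ^ suc n) (sym (length-vertices-zero (suc n))) (m^n>0 2 (suc n))
length-vertices≤2^n (suc n) (suc k) = begin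
  length (vertices (suc n) (suc k))                       ≡⟨ length-vertices-suc n k ⟩
  length (vertices n (suc k)) + length (vertices n k)     ≤⟨ +-mono-≤ (length-vertices≤2^n n (suc k)) (length-vertices≤2^n n k) ⟩
  2 ^ n + 2 ^ n                                           ≡⟨ cong (2 ^ n +_) (+-identityʳ _) ⟨
  2 ^ suc n                                               ∎
  where open ≤-Reasoning

-- For k = 2 this makes ℓ logarithmic in n, as is needed when there are only quadratically many
-- vertices.
length-vertices≤n^k : ∀ n k → length (vertices n k) ≤ n ^ k
length-vertices≤n^k n zero = ≤-reflexive (length-vertices-zero n)
length-vertices≤n^k zero (suc k) = z≤n
length-vertices≤n^k (suc n) (suc k) = begin
  length (vertices (suc n) (suc k))                       ≡⟨ length-vertices-suc n k ⟩
  length (vertices n (suc k)) + length (vertices n k)     ≤⟨ +-mono-≤ (length-vertices≤n^k n (suc k)) (length-vertices≤n^k n k) ⟩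
  n * n ^ k + n ^ k                                       ≡⟨ +-comm (n * n ^ k) (n ^ k) ⟩
  suc n * n ^ k                                           ≤⟨ *-monoʳ-≤ (suc n) (^-monoˡ-≤ k (n≤1+n n)) ⟩
  suc n ^ suc k                                           ∎
  where open ≤-Reasoning

-- multichoose k s is the binomial coefficient (k + s choose k).
multichoose : ℕ → ℕ → ℕ
multichoose zero s = 1
multichoose (suc k) zero = 1
multichoose (suc k) (suc s) = multichoose (suc k) s + multichoose k (suc s)

inside : ∀ {n k} → Subset n → V (KG n k) → Bool
inside p v = proj₁ v ⊆ᵇ p

-- Pascal's rule: if the first element lies in p, the two summands of `multichoose` bound the
-- subsets avoiding it and those using it; if not, the subsets avoiding it suffice.
count-inside : ∀ {n} k s (p : Subset n) → k + s ≤ ∣ p ∣ → multichoose k s ≤ count (inside p) (vertices n k)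
count-inside zero s [] h = ≤-refl
count-inside zero s (b ∷ p) h = begin
  1                                                       ≤⟨ count-inside zero 0 p z≤n ⟩
  count (inside p) (vertices _ 0)                         ≡⟨ count-map (inside (b ∷ p)) drop-member (vertices _ 0) ⟨
  count (inside (b ∷ p)) (List.map drop-member (vertices _ 0)) ≤⟨ m≤m+n _ _ ⟩
  count (inside (b ∷ p)) (List.map drop-member (vertices _ 0)) + 0 ≡⟨ count-++ (inside (b ∷ p)) (List.map drop-member (vertices _ 0)) [] ⟨
  count (inside (b ∷ p)) (vertices (suc _) 0) ∎
  where open ≤-Reasoning
count-inside (suc k) s (b ∷ p) h = begin
  multichoose (suc k) s     ≤⟨ main b s h ⟩
  count (inside p) (vertices _ (suc k)) + count (λ v → b ∧ inside p v) (vertices _ k)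
    ≡⟨ cong₂ _+_ (count-map (inside (b ∷ p)) drop-member (vertices _ (suc k))) (count-map (inside (b ∷ p)) add-member (vertices _ k)) ⟨
  count (inside (b ∷ p)) (List.map drop-member (vertices _ (suc k))) + count (inside (b ∷ p)) (List.map add-member (vertices _ k))
    ≡⟨ count-++ (inside (b ∷ p)) (List.map drop-member (vertices _ (suc k))) (List.map add-member (vertices _ k)) ⟨
  count (inside (b ∷ p)) (vertices (suc _) (suc k)) ∎
  where
  open ≤-Reasoning
  main : ∀ b s → suc k + s ≤ ∣ b ∷ p ∣ →
    multichoose (suc k) s ≤ count (inside p) (vertices _ (suc k)) + count (λ v → b ∧ inside p v) (vertices _ k)
  main false s h = ≤-trans (count-inside (suc k) s p h) (m≤m+n _ _)
  main true zero (s≤s h) = ≤-trans (≤-trans (one k) (count-inside k zero p h)) (m≤n+m _ _)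
    where
    one : ∀ k → 1 ≤ multichoose k 0
    one zero = ≤-refl
    one (suc k) = ≤-refl
  main true (suc s) (s≤s h) = +-mono-≤
    (count-inside (suc k) s p (subst (_≤ ∣ p ∣) (+-suc k s) h))
    (count-inside k (suc s) p h)

empty-∩ : ∀ {n} (x : SV n) {p q : Subset n} → p ⊆ᵇ positive x ≡ true → q ⊆ᵇ negative x ≡ true → Empty (p ∩ q)
empty-∩ x {p} {q} hp hq (i , i∈) with i∈p , i∈q ← x∈p∩q⁻ p q i∈ = go x i∈p i∈q hp hq
  where
  go : ∀ {n} (x : SV n) {p q : Subset n} {i} → p [ i ]= true → q [ i ]= true →
    p ⊆ᵇ positive x ≡ true → q ⊆ᵇ negative x ≡ true → ⊥
  go (just true ∷ x) here here hp ()
  go (just false ∷ x) here here () hq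
  go (nothing ∷ x) here here () hq
  go (a ∷ x) {b ∷ p} {c ∷ q} (there i∈p) (there i∈q) hp hq =
    go x i∈p i∈q (tails (a ∷ x) b hp) (tails′ a c hq)
    where
    tails : ∀ {n} (x : SV (suc n)) b {p : Subset n} → (b ∷ p) ⊆ᵇ positive x ≡ true → p ⊆ᵇ positive (tail x) ≡ true
    tails (just true ∷ x) true h = h
    tails (just true ∷ x) false h = h
    tails (just false ∷ x) false h = h
    tails (nothing ∷ x) false h = h
    tails′ : ∀ a c → (c ∷ q) ⊆ᵇ negative (a ∷ x) ≡ true → q ⊆ᵇ negative x ≡ true
    tails′ a c h = tails (neg (a ∷ x)) c h

disjoint-sizes : ∀ {n} (p q : Subset n) → Empty (p ∩ q) → ∣ p ∣ + ∣ q ∣ ≤ n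
disjoint-sizes [] [] e = z≤n
disjoint-sizes (true ∷ p) (true ∷ q) e = ⊥-elim (e (fzero , here))
disjoint-sizes (true ∷ p) (false ∷ q) e = s≤s (disjoint-sizes p q (drop-∷-Empty e))
disjoint-sizes {suc n} (false ∷ p) (true ∷ q) e =
  subst (_≤ suc n) (sym (+-suc ∣ p ∣ ∣ q ∣)) (s≤s (disjoint-sizes p q (drop-∷-Empty e)))
disjoint-sizes (false ∷ p) (false ∷ q) e = m≤n⇒m≤1+n (disjoint-sizes p q (drop-∷-Empty e))

-- A set is coloured by its least element if that is among the first j points. All other sets share
-- the last colour: they lie in b < 2 k points and hence meet.
kneser-colourable : ∀ {b k} j → b < k + k → Colourable (KG (j + b) k) (suc j)
kneser-colourable {b} {k} zero small = (λ _ → fzero) , λ { {p , refl} {q , e} adj _ →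
  <⇒≱ small (subst (λ z → ∣ p ∣ + z ≤ b) e (disjoint-sizes p q adj)) }
kneser-colourable {b} {k} (suc j) small with f , proper ← kneser-colourable {b} {k} j small = g , proper′
  where
  g : V (KG (suc j + b) k) → Fin (2 + j)
  g (true ∷ p , e) = fzero
  g (false ∷ p , e) = fsuc (f (p , e))
  proper′ : ∀ {u v} → Adj (KG (suc j + b) k) u v → g u ≢ g v
  proper′ {true ∷ p , _} {true ∷ q , _} adj _ = adj (fzero , here)
  proper′ {false ∷ p , e} {false ∷ q , e′} adj eq =
    proper {p , e} {q , e′} (drop-∷-Empty adj) (suc-inj eq)
    where
    suc-inj : ∀ {n} {i j : Fin n} → fsuc i ≡ fsuc j → i ≡ j
    suc-inj refl = refl

-- Orienting the Kneser graph along a tournament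

index : ∀ {n k} → V (KG n k) → Fin (length (vertices n k))
index v = Any.index (∈-vertices v)

index-injective : ∀ {n k} {u v : V (KG n k)} → index u ≡ index v → u ≡ v
index-injective {n} {k} {u} {v} e = trans (Any.lookup-index (∈-vertices u))
  (trans (cong (List.lookup (vertices n k)) e) (sym (Any.lookup-index (∈-vertices v))))

module _ {n k r : ℕ} (1≤k : 1 ≤ k) (t : Tournament (length (vertices n k)) r) where
  open Tournament t

  -- A set disjoint from itself is empty, contrary to 1 ≤ k.
  adj-≢ : ∀ {u v} → Adj (KG n k) u v → u ≢ v
  adj-≢ {p , e} adj refl = <⇒≱ 1≤k (subst (_≤ 0) e (subst (λ z → ∣ z ∣ ≤ 0)
    (∩-idem p) (subst (λ z → ∣ z ∣ ≤ 0) (sym (Empty-unique adj)) (≤-reflexive (∣⊥∣≡0 n)))))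

  adj-sym : ∀ {u v} → Adj (KG n k) u v → Adj (KG n k) v u
  adj-sym {p , _} {q , _} = subst Empty (∩-comm p q)

  arrow : V (KG n k) → V (KG n k) → Bool
  arrow u v = beats (index u) (index v)

  arrow-swap : ∀ {u v} → u ≢ v → arrow v u ≡ not (arrow u v)
  arrow-swap u≢v = beats-swap (u≢v ∘ index-injective)

  orientation : Orientation (KG n k)
  orientation = record
    { Arc = λ u v → Adj (KG n k) u v × arrow u v ≡ true
    ; Arc? = λ u v → ¬? (nonempty? (proj₁ u ∩ proj₁ v)) ×-dec (arrow u v Bool.≟ true)
    ; along = proj₁
    ; total = λ {u} {v} adj → total′ {u} {v} adj (arrow u v) refl
    ; anti = λ {u} {v} (adj , e) (_ , e′) → not-¬ (sym e) (trans (sym e′) (arrow-swap (adj-≢ {u} {v} adj)))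
    }
    where
    total′ : ∀ {u v} → Adj (KG n k) u v → ∀ b → arrow u v ≡ b →
      (Adj (KG n k) u v × arrow u v ≡ true) ⊎ (Adj (KG n k) v u × arrow v u ≡ true)
    total′ adj true e = inj₁ (adj , e)
    total′ {u} {v} adj false e = inj₂ (adj-sym {u} {v} adj , trans (arrow-swap (adj-≢ {u} {v} adj)) (cong not e))

  four-cycle : (P : V (KG n k) → Set) → ∀ {a b c d} → P a → P b → P c → P d →
    Arc orientation a b → Arc orientation b c → Arc orientation c d → Arc orientation d a →
    DirectedCycleIn orientation P
  four-cycle P {a} {b} {c} {d} pa pb pc pd ab bc cd da = record
    { m = 3 ; w = w ; inj = λ {i} {j} → inj i j ; inP = inP ; step = step ; close = da }
    where
    w : Fin 4 → V (KG n k)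
    w fzero = a
    w (fsuc fzero) = b
    w (fsuc (fsuc fzero)) = c
    w (fsuc (fsuc (fsuc fzero))) = d
    inP : ∀ i → P (w i)
    inP fzero = pa
    inP (fsuc fzero) = pb
    inP (fsuc (fsuc fzero)) = pc
    inP (fsuc (fsuc (fsuc fzero))) = pd
    step : ∀ (i : Fin 3) → Arc orientation (w (inject₁ i)) (w (fsuc i))
    step fzero = ab
    step (fsuc fzero) = bc
    step (fsuc (fsuc fzero)) = cd
    a≢b : a ≢ b
    a≢b refl = anti orientation {a} {a} ab ab
    b≢c : b ≢ c
    b≢c refl = anti orientation {b} {b} bc bc
    c≢d : c ≢ d
    c≢d refl = anti orientation {c} {c} cd cd
    d≢a : d ≢ a
    d≢a refl = anti orientation {d} {d} da da
    a≢c : a ≢ c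
    a≢c refl = anti orientation {a} {b} ab bc
    b≢d : b ≢ d
    b≢d refl = anti orientation {b} {c} bc cd
    inj : ∀ i j → w i ≡ w j → i ≡ j
    inj fzero fzero _ = refl
    inj fzero (fsuc fzero) e = ⊥-elim (a≢b e)
    inj fzero (fsuc (fsuc fzero)) e = ⊥-elim (a≢c e)
    inj fzero (fsuc (fsuc (fsuc fzero))) e = ⊥-elim (d≢a (sym e))
    inj (fsuc fzero) fzero e = ⊥-elim (a≢b (sym e))
    inj (fsuc fzero) (fsuc fzero) _ = refl
    inj (fsuc fzero) (fsuc (fsuc fzero)) e = ⊥-elim (b≢c e)
    inj (fsuc fzero) (fsuc (fsuc (fsuc fzero))) e = ⊥-elim (b≢d e)
    inj (fsuc (fsuc fzero)) fzero e = ⊥-elim (a≢c (sym e))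
    inj (fsuc (fsuc fzero)) (fsuc fzero) e = ⊥-elim (b≢c (sym e))
    inj (fsuc (fsuc fzero)) (fsuc (fsuc fzero)) _ = refl
    inj (fsuc (fsuc fzero)) (fsuc (fsuc (fsuc fzero))) e = ⊥-elim (c≢d e)
    inj (fsuc (fsuc (fsuc fzero))) fzero e = ⊥-elim (d≢a e)
    inj (fsuc (fsuc (fsuc fzero))) (fsuc fzero) e = ⊥-elim (b≢d (sym e))
    inj (fsuc (fsuc (fsuc fzero))) (fsuc (fsuc fzero)) e = ⊥-elim (c≢d (sym e))
    inj (fsuc (fsuc (fsuc fzero))) (fsuc (fsuc (fsuc fzero))) _ = refl

  -- An injective colouring; it provides the starting point for finding the least number of colours.
  dicolourable-by-index : DiColourable orientation (length (vertices n k))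
  dicolourable-by-index = index , λ i cyc → let open DirectedCycleIn cyc in
    adj-≢ {w (fromℕ m)} {w fzero} (proj₁ close) (index-injective (trans (inP (fromℕ m)) (sym (inP fzero))))

  no-one-way : ∀ us vs → length us ≡ r → length vs ≡ r → Unique us → Unique vs →
    (∀ {u v} → u ∈ us → v ∈ vs → Arc orientation u v) → ⊥
  no-one-way us vs lu lv uu uv arcs = no-dominance (List.map index us) (List.map index vs)
    (trans (length-map index us) lu) (trans (length-map index vs) lv)
    (Unique.map⁺ index-injective uu) (Unique.map⁺ index-injective uv)
    apart dominated
    where
    apart : ∀ {i} → i ∈ List.map index us → i ∉ List.map index vs
    apart i∈ i∈′ with u , u∈ , refl ← ∈-map⁻ index i∈ with v , v∈ , e ← ∈-map⁻ index i∈′ =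
      adj-≢ {u} {v} (proj₁ (arcs u∈ v∈)) (index-injective e)
    dominated : ∀ {i j} → i ∈ List.map index us → j ∈ List.map index vs → beats i j ≡ true
    dominated i∈ j∈ with u , u∈ , refl ← ∈-map⁻ index i∈ with v , v∈ , refl ← ∈-map⁻ index j∈ =
      proj₂ (arcs u∈ v∈)

  -- An alternating rectangle of `arrow` is a directed 4-cycle. Without one, `homogeneous` yields r
  -- vertices on each side with all arcs going one way, which the tournament forbids in either
  -- direction.
  monochromatic-cycle : ∀ {P : V (KG n k) → Set} {us vs} → 1 ≤ r → r + r ≤ length us → r + r ≤ length vs →
    Unique us → Unique vs → (∀ {u} → u ∈ us → P u) → (∀ {v} → v ∈ vs → P v) →
    (∀ {u v} → u ∈ us → v ∈ vs → Adj (KG n k) u v) → ¬ ¬ DirectedCycleIn orientation P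
  monochromatic-cycle {P} {us} {vs} 1≤r bu bv uu uv pu pv adj none = finish (homogeneous arrow 1≤r bu bv uu uv norect)
    where
    forth : ∀ {u v} → u ∈ us → v ∈ vs → arrow u v ≡ true → Arc orientation u v
    forth u∈ v∈ e = adj u∈ v∈ , e
    back : ∀ {u v} → u ∈ us → v ∈ vs → arrow u v ≡ false → Arc orientation v u
    back {u} {v} u∈ v∈ e = adj-sym {u} {v} (adj u∈ v∈) , trans (arrow-swap (adj-≢ {u} {v} (adj u∈ v∈))) (cong not e)
    norect : ∀ {x x′ y y′} → x ∈ us → x′ ∈ us → y ∈ vs → y′ ∈ vs →
      arrow x y ≡ true → arrow x′ y ≡ false → arrow x′ y′ ≡ true → arrow x y′ ≡ false → ⊥
    norect x∈ x′∈ y∈ y′∈ e₁ e₂ e₃ e₄ = none (four-cycle P (pu x∈) (pv y∈) (pu x′∈) (pv y′∈)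
      (forth x∈ y∈ e₁) (back x′∈ y∈ e₂) (forth x′∈ y′∈ e₃) (back x∈ y′∈ e₄))
    finish : (Σ (Chosen r (_∈ us)) λ us′ → Σ (Chosen r (_∈ vs)) λ vs′ → ∃[ b ]
      (∀ {x y} → x ∈ Chosen.list us′ → y ∈ Chosen.list vs′ → arrow x y ≡ b)) → ⊥
    finish (chosen us′ lu uu′ su , chosen vs′ lv uv′ sv , true , e) =
      no-one-way us′ vs′ lu lv uu′ uv′ (λ u∈ v∈ → forth (su u∈) (sv v∈) (e u∈ v∈))
    finish (chosen us′ lu uu′ su , chosen vs′ lv uv′ sv , false , e) =
      no-one-way vs′ us′ lv lu uv′ uu′ (λ v∈ u∈ → back (su u∈) (sv v∈) (e u∈ v∈))

-- The first inequality gives a popular colour in every set of k + s points by pigeonhole; the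
-- second is the hypothesis of `few-colours-collide` with k + s in the place of k.
not-dicolourable : ∀ {n k r s m} (1≤k : 1 ≤ k) (t : Tournament (length (vertices (suc n) k)) r) → 1 ≤ r →
  m * (r + r) < multichoose k s → m + ((k + s) + (k + s)) ≤ 2 + n → ¬ DiColourable (orientation 1≤k t) m
not-dicolourable {n} {k} {r} {s} {m} 1≤k t 1≤r many few (f , acyclic) =
  few-colours-collide popular popular-mono popular-exists not-both (≤-trans 1≤k (m≤m+n k s)) few
  where
  inClass : ℕ → Subset (suc n) → V (KG (suc n) k) → Bool
  inClass i p v = inside p v ∧ (toℕ (f v) ≡ᵇ i)

  popular : ℕ → Subset (suc n) → Bool
  popular i p = r + r ≤ᵇ count (inClass i p) (vertices (suc n) k)

  ⊆ᵇ-trans : ∀ {n} (p q s : Subset n) → p ⊆ᵇ q ≡ true → q ⊆ᵇ s ≡ true → p ⊆ᵇ s ≡ true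
  ⊆ᵇ-trans [] [] [] _ _ = refl
  ⊆ᵇ-trans (true ∷ p) (true ∷ q) (true ∷ s) a b = ⊆ᵇ-trans p q s a b
  ⊆ᵇ-trans (false ∷ p) (true ∷ q) (true ∷ s) a b = ⊆ᵇ-trans p q s a b
  ⊆ᵇ-trans (false ∷ p) (false ∷ q) (c ∷ s) a b = ⊆ᵇ-trans p q s a b

  popular-mono : ∀ i p q → p ⊆ᵇ q ≡ true → popular i p ≡ true → popular i q ≡ true
  popular-mono i p q p⊆q h = ≤⇒≤ᵇ≡true (≤-trans (≤ᵇ≡true⇒≤ {r + r} h)
    (count-mono (inClass i p) (inClass i q) weaker (vertices (suc n) k)))
    where
    weaker : ∀ v → inClass i p v ≡ true → inClass i q v ≡ true
    weaker v e with a , b ← ∧-true {inside p v} e = cong₂ _∧_ (⊆ᵇ-trans (proj₁ v) p q a p⊆q) b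

  popular-exists : ∀ p → k + s ≤ ∣ p ∣ → ∃[ i ] (i < m × popular i p ≡ true)
  popular-exists p big with i , i<m , h ← popular-class (inside p) (toℕ ∘ f) (r + r) (vertices (suc n) k) m
    (<-≤-trans many (≤-trans (count-inside k s p big)
      (count-mono _ _ (λ v e → cong₂ _∧_ e (Equivalence.to T-≡ (<⇒<ᵇ (toℕ<n (f v))))) (vertices (suc n) k)))) =
    i , i<m , ≤⇒≤ᵇ≡true h

  not-both : ∀ i x → popular i (positive x) ≡ true → popular i (negative x) ≡ true → ⊥
  not-both i x h h′ = monochromatic-cycle 1≤k t {P = λ v → toℕ (f v) ≡ i} 1≤r
    (≤ᵇ≡true⇒≤ {r + r} h) (≤ᵇ≡true⇒≤ {r + r} h′) (uniq (positive x)) (uniq (negative x))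
    (λ v∈ → colour (positive x) v∈) (λ v∈ → colour (negative x) v∈)
    (λ u∈ v∈ → empty-∩ x (member (positive x) u∈) (member (negative x) v∈))
    no-cycle
    where
    class : Subset (suc n) → List (V (KG (suc n) k))
    class p = filterᵇ (inClass i p) (vertices (suc n) k)
    uniq : ∀ p → Unique (class p)
    uniq p = Unique.filter⁺ (T? ∘ inClass i p) (unique-vertices (suc n) k)
    member : ∀ p {v} → v ∈ class p → proj₁ v ⊆ᵇ p ≡ true
    member p v∈ = proj₁ (∧-true (proj₂ (∈-filterᵇ⁻ (inClass i p) {vertices (suc n) k} v∈)))
    colour : ∀ p {v} → v ∈ class p → toℕ (f v) ≡ i
    colour p {v} v∈ = ≡ᵇ⇒≡ (toℕ (f v)) i (Equivalence.from T-≡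
      (proj₂ (∧-true {inside p v} (proj₂ (∈-filterᵇ⁻ (inClass i p) {vertices (suc n) k} v∈)))))
    no-cycle : ¬ DirectedCycleIn (orientation 1≤k t) (λ v → toℕ (f v) ≡ i)
    -- `popular` treats colours as natural numbers; the first vertex of the cycle gives the colour
    -- back as an element of `Fin m`.
    no-cycle cyc = acyclic (f (w fzero)) (record
      { m = DirectedCycleIn.m cyc ; w = w ; inj = DirectedCycleIn.inj cyc ; step = DirectedCycleIn.step cyc
      ; close = DirectedCycleIn.close cyc ; inP = λ j → toℕ-injective (trans (inP j) (sym (inP fzero))) })
      where open DirectedCycleIn cyc using (w; inP)

-- Numerical estimates

multichoose-sym : ∀ k s → multichoose k s ≡ multichoose s k
multichoose-sym zero zero = refl
multichoose-sym zero (suc s) = refl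
multichoose-sym (suc k) zero = refl
multichoose-sym (suc k) (suc s) =
  trans (cong₂ _+_ (multichoose-sym (suc k) s) (multichoose-sym k (suc s))) (+-comm (multichoose s (suc k)) _)

multichoose-+ : ∀ k s j → multichoose k s ≤ multichoose k (s + j)
multichoose-+ k s zero = ≤-reflexive (cong (multichoose k) (sym (+-identityʳ s)))
multichoose-+ k s (suc j) = ≤-trans (multichoose-+ k s j)
  (≤-trans (step k (s + j)) (≤-reflexive (cong (multichoose k) (sym (+-suc s j)))))
  where
  step : ∀ k s → multichoose k s ≤ multichoose k (suc s)
  step zero s = ≤-refl
  step (suc k) s = m≤m+n _ _

multichoose-monoʳ : ∀ k {s s′} → s ≤ s′ → multichoose k s ≤ multichoose k s′
multichoose-monoʳ k {s} s≤s′ = subst (λ z → multichoose k s ≤ multichoose k z) (m+[n∸m]≡n s≤s′) (multichoose-+ k s _)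

multichoose-monoˡ : ∀ {k k′} s → k ≤ k′ → multichoose k s ≤ multichoose k′ s
multichoose-monoˡ {k} {k′} s k≤k′ =
  subst₂ _≤_ (multichoose-sym s k) (multichoose-sym s k′) (multichoose-monoʳ s k≤k′)

multichoose-1 : ∀ s → multichoose 1 s ≡ suc s
multichoose-1 zero = refl
multichoose-1 (suc s) = trans (cong (_+ 1) (multichoose-1 s)) (+-comm (suc s) 1)

multichoose-2 : ∀ s → 2 * multichoose 2 s ≡ (1 + s) * (2 + s)
multichoose-2 zero = refl
multichoose-2 (suc s) = begin
  2 * (multichoose 2 s + multichoose 1 (suc s))   ≡⟨ *-distribˡ-+ 2 (multichoose 2 s) _ ⟩
  2 * multichoose 2 s + 2 * multichoose 1 (suc s) ≡⟨ cong₂ (λ a b → a + 2 * b) (multichoose-2 s) (multichoose-1 (suc s)) ⟩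
  (1 + s) * (2 + s) + 2 * (2 + s)                 ≡⟨ identity s ⟩
  (2 + s) * (3 + s)                               ∎
  where
  open ≡-Reasoning
  identity : ∀ s → (1 + s) * (2 + s) + 2 * (2 + s) ≡ (2 + s) * (3 + s)
  identity = solve-∀

multichoose-3 : ∀ s → 6 * multichoose 3 s ≡ (1 + s) * (2 + s) * (3 + s)
multichoose-3 zero = refl
multichoose-3 (suc s) = begin
  6 * (multichoose 3 s + multichoose 2 (suc s))         ≡⟨ split (multichoose 3 s) (multichoose 2 (suc s)) ⟩
  6 * multichoose 3 s + 3 * (2 * multichoose 2 (suc s)) ≡⟨ cong₂ (λ a b → a + 3 * b) (multichoose-3 s) (multichoose-2 (suc s)) ⟩
  (1 + s) * (2 + s) * (3 + s) + 3 * ((2 + s) * (3 + s)) ≡⟨ identity s ⟩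
  (2 + s) * (3 + s) * (4 + s)                           ∎
  where
  open ≡-Reasoning
  split : ∀ a b → 6 * (a + b) ≡ 6 * a + 3 * (2 * b)
  split = solve-∀
  identity : ∀ s → (1 + s) * (2 + s) * (3 + s) + 3 * ((2 + s) * (3 + s)) ≡ (2 + s) * (3 + s) * (4 + s)
  identity = solve-∀

quadratic-bound : ∀ {m s r} → 4 * m ≤ s → r ≤ s → m * (r + r) < multichoose 2 s
quadratic-bound {m} {s} {r} 4m≤s r≤s = *-cancelˡ-< 2 _ _ (begin-strict
  2 * (m * (r + r))     ≡⟨ regroup m r ⟩
  4 * m * r             ≤⟨ *-mono-≤ 4m≤s r≤s ⟩
  s * s                 <⟨ s≤s (m≤m+n (s * s) (s * 3 + 1)) ⟩
  suc (s * s + (s * 3 + 1)) ≡⟨ expand s ⟩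
  (1 + s) * (2 + s)     ≡⟨ multichoose-2 s ⟨
  2 * multichoose 2 s   ∎)
  where
  open ≤-Reasoning
  regroup : ∀ m r → 2 * (m * (r + r)) ≡ 4 * m * r
  regroup = solve-∀
  expand : ∀ s → suc (s * s + (s * 3 + 1)) ≡ (1 + s) * (2 + s)
  expand = solve-∀

-- Here x will be the larger of k and s, and `suc (2 * n)` is the value of r for ℓ = n. A cubic in x
-- has to exceed a quadratic one.
cubic-bound : ∀ {m n x} → 31 ≤ x → 4 * m ≤ x → n ≤ 6 * x + 3 →
  m * (suc (2 * n) + suc (2 * n)) < multichoose 3 x
cubic-bound {m} {n} {x} 31≤x 4m≤x n≤ = *-cancelˡ-< 6 _ _ (begin-strict
  6 * (m * (suc (2 * n) + suc (2 * n)))   ≡⟨ regroup m n ⟩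
  6 * (4 * m * n) + 3 * (4 * m)           ≤⟨ +-mono-≤ (*-monoʳ-≤ 6 (*-mono-≤ 4m≤x n≤)) (*-monoʳ-≤ 3 4m≤x) ⟩
  6 * (x * (6 * x + 3)) + 3 * x           <⟨ polynomial (x ∸ 31) (sym (m+[n∸m]≡n 31≤x)) ⟩
  (1 + x) * (2 + x) * (3 + x)             ≡⟨ multichoose-3 x ⟨
  6 * multichoose 3 x                     ∎)
  where
  open ≤-Reasoning
  regroup : ∀ m n → 6 * (m * (suc (2 * n) + suc (2 * n))) ≡ 6 * (4 * m * n) + 3 * (4 * m)
  regroup = solve-∀
  -- After substituting x = 31 + y the difference has only positive coefficients; at x = 30 the
  -- inequality fails.
  expand : ∀ y → (32 + y) * (33 + y) * (34 + y) ≡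
    suc (6 * ((31 + y) * (6 * (31 + y) + 3)) + 3 * (31 + y)) + (656 + y * 1013 + y * y * 63 + y * y * y)
  expand = solve-∀
  polynomial : ∀ y → x ≡ 31 + y → 6 * (x * (6 * x + 3)) + 3 * x < (1 + x) * (2 + x) * (3 + x)
  polynomial y refl = ≤-trans (m≤m+n _ _) (≤-reflexive (sym (expand y)))

-- At e = 7 this fails, with 135 against 128; from e = 8 on, doubling outruns adding 16.
exponential-bound : ∀ e → 8 ≤ e → 16 * e + 23 ≤ 2 ^ e
exponential-bound e 8≤e = subst (λ z → 16 * z + 23 ≤ 2 ^ z) (m+[n∸m]≡n 8≤e) (go (e ∸ 8))
  where
  open ≤-Reasoning
  go : ∀ j → 16 * (8 + j) + 23 ≤ 2 ^ (8 + j)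
  go zero = ≤ᵇ⇒≤ 151 256 _
  go (suc j) = begin
    16 * (9 + j) + 23                             ≤⟨ m≤m+n _ (135 + 16 * j) ⟩
    16 * (9 + j) + 23 + (135 + 16 * j)            ≡⟨ double j ⟩
    2 * (16 * (8 + j) + 23)                       ≤⟨ *-monoʳ-≤ 2 (go j) ⟩
    2 * 2 ^ (8 + j)                               ∎
    where
    double : ∀ j → 16 * (9 + j) + 23 + (135 + 16 * j) ≡ 2 * (16 * (8 + j) + 23)
    double = solve-∀

-- This turns 300 ≤ n ≤ a b + c into a lower bound for b. The threshold 300 lies above 6 * 30 + 3 =
-- 183 and 16 * 7 + 23 = 135, the values used below.
linear-bound : ∀ a b c d → 300 ≤ a * b + c → a * d + c < 300 → d < b
linear-bound a b c d big small = ≰⇒> λ b≤d → <⇒≱ small (≤-trans big (+-monoˡ-≤ c (*-monoʳ-≤ a b≤d)))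

quarter : ∀ t → ∃[ s ] (4 * s ≤ t × t ≤ 4 * s + 3)
quarter t = t / 4 , subst (_≤ t) (*-comm (t / 4) 4) (m/n*n≤m t 4) , (begin
  t                     ≡⟨ m≡m%n+[m/n]*n t 4 ⟩
  t % 4 + t / 4 * 4     ≤⟨ +-mono-≤ (≤-pred (m%n<n t 4)) (≤-reflexive (*-comm (t / 4) 4)) ⟩
  3 + 4 * (t / 4)       ≡⟨ +-comm 3 _ ⟩
  4 * (t / 4) + 3       ∎)
  where open ≤-Reasoning

-- `suc (2 * ℓ)` is the least r that `tournament` accepts, and `4 * m + 2 ≤ s` is what m < χ / 16
-- will provide.
Sufficient : ℕ → ℕ → ℕ → ℕ → Set
Sufficient n k s ℓ = length (vertices n k) ≤ 2 ^ ℓ ×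
  (∀ m → 4 * m + 2 ≤ s → m * (suc (2 * ℓ) + suc (2 * ℓ)) < multichoose k s)

-- With e = ⌊(s - 1) / 4⌋ and ℓ = 2 e, the value r = 4 e + 1 is at most s, as `quadratic-bound`
-- asks, while n ≤ 16 e + 23 ≤ 2 ^ e bounds the number of vertices by 2 ^ ℓ.
sufficient-pairs : ∀ n s → 300 ≤ n → n ≤ 4 * s + 7 → ∃[ ℓ ] Sufficient n 2 s ℓ
sufficient-pairs n zero 300≤n n≤ = ⊥-elim (<⇒≱ (≤ᵇ⇒≤ 8 300 _) (≤-trans 300≤n n≤))
sufficient-pairs n (suc σ) 300≤n n≤ with e , 4e≤σ , σ≤ ← quarter σ =
  e * 2 , ≤-trans (length-vertices≤n^k n 2) (≤-trans (^-monoˡ-≤ 2 n≤2^e) (≤-reflexive (^-*-assoc 2 e 2))) ,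
  λ m h → quadratic-bound {m} (m+n≤o⇒m≤o (4 * m) h) (s≤s (≤-trans (≤-reflexive (four e)) 4e≤σ))
  where
  open ≤-Reasoning
  four : ∀ e → 2 * (e * 2) ≡ 4 * e
  four = solve-∀
  expand : ∀ e → 4 * suc (4 * e + 3) + 7 ≡ 16 * e + 23
  expand = solve-∀
  n≤16e+23 : n ≤ 16 * e + 23
  n≤16e+23 = begin
    n                          ≤⟨ n≤ ⟩
    4 * suc σ + 7              ≤⟨ +-monoˡ-≤ 7 (*-monoʳ-≤ 4 (s≤s σ≤)) ⟩
    4 * suc (4 * e + 3) + 7    ≡⟨ expand e ⟩
    16 * e + 23                ∎
  n≤2^e : n ≤ 2 ^ e
  n≤2^e = ≤-trans n≤16e+23 (exponential-bound e
    (linear-bound 16 e 23 7 (≤-trans 300≤n n≤16e+23) (≤ᵇ⇒≤ 136 300 _)))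

-- By symmetry of the binomial coefficient the smaller of k and s can be lowered to 3. For the
-- larger one, x, the hypothesis gives n ≤ 6 x + 3, and `cubic-bound` applies.
sufficient-large : ∀ n k s → 300 ≤ n → 3 ≤ k → n ≤ 2 * k + (4 * s + 3) → Sufficient n k s n
sufficient-large n k s 300≤n 3≤k n≤ = length-vertices≤2^n n k , many
  where
  open ≤-Reasoning
  six : ∀ x → 2 * x + (4 * x + 3) ≡ 6 * x + 3
  six = solve-∀
  31≤ : ∀ x → n ≤ 6 * x + 3 → 31 ≤ x
  31≤ x n≤ = linear-bound 6 x 3 30 (≤-trans 300≤n n≤) (≤ᵇ⇒≤ 184 300 _)
  many : ∀ m → 4 * m + 2 ≤ s → m * (suc (2 * n) + suc (2 * n)) < multichoose k s
  -- For m = 0 the hypothesis does not give 3 ≤ s, but only the positivity of `multichoose k s` is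
  -- asked.
  many zero h = multichoose-monoˡ {0} {k} s z≤n
  many m@(suc m′) h with ≤-total k s
  ... | inj₁ k≤s = <-≤-trans (cubic-bound {m} (31≤ s n≤6s+3) (m+n≤o⇒m≤o (4 * m) h) n≤6s+3) (multichoose-monoˡ s 3≤k)
    where
    n≤6s+3 : n ≤ 6 * s + 3
    n≤6s+3 = ≤-trans n≤ (≤-trans (+-monoˡ-≤ _ (*-monoʳ-≤ 2 k≤s)) (≤-reflexive (six s)))
  ... | inj₂ s≤k = <-≤-trans
    (cubic-bound {m} (31≤ k n≤6k+3) (≤-trans (m+n≤o⇒m≤o (4 * m) h) s≤k) n≤6k+3)
    (subst (_≤ multichoose k s) (multichoose-sym k 3) (multichoose-monoʳ k 3≤s))
    where
    n≤6k+3 : n ≤ 6 * k + 3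
    n≤6k+3 = ≤-trans n≤ (≤-trans (+-monoʳ-≤ (2 * k) (+-monoˡ-≤ 3 (*-monoʳ-≤ 4 s≤k))) (≤-reflexive (six k)))
    3≤s : 3 ≤ s
    3≤s = ≤-trans (+-mono-≤ {1} {4 * m} {2} {2} (s≤s z≤n) ≤-refl) h

sufficient : ∀ n k s → 300 ≤ n → 2 ≤ k → n ≤ 2 * k + (4 * s + 3) → ∃[ ℓ ] Sufficient n k s ℓ
sufficient n k s 300≤n 2≤k n≤ with m≤n⇒m<n∨m≡n 2≤k
... | inj₁ 3≤k = n , sufficient-large n k s 300≤n 3≤k n≤
... | inj₂ refl = sufficient-pairs n s 300≤n (≤-trans n≤ (≤-reflexive (shift s)))
  where
  shift : ∀ s → 4 + (4 * s + 3) ≡ 4 * s + 7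
  shift = solve-∀

-- Existence of the dichromatic number, and the conclusion

least-exists : ∀ {P : ℕ → Set} b → P b → ¬ ¬ (∃[ d ] (P d × (∀ d′ → P d′ → d ≤ d′)))
least-exists {P} b pb none = below (suc b) b ≤-refl pb
  where
  -- Infinite descent. As P is not assumed decidable, a least element is obtained only up to double
  -- negation.
  below : ∀ u a → a < u → ¬ P a
  below (suc u) a (s≤s a≤u) pa = none (a , pa , λ d′ pd′ → ≮⇒≥ λ d′<a → below u d′ (<-≤-trans d′<a a≤u) pd′)

-- `kneser-colourable` with b = 2 k - 1 remaining points and j = n - 2 k + 1 uses n - 2 k + 2
-- colours.
chromatic-upper-bound : ∀ {n k c} → 1 ≤ k → 2 * k ≤ n → IsChromaticNumber (KG n k) c → c ≤ (n ∸ 2 * k) + 2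
chromatic-upper-bound {n} {k} {c} 1≤k 2k≤n (_ , minimal) = minimal _
  (subst₂ (λ a b → Colourable (KG a k) b) sum≡n (+-comm 2 t) (kneser-colourable (suc t) small))
  where
  t = n ∸ 2 * k
  2k≡ : suc (2 * k ∸ 1) ≡ 2 * k
  2k≡ = m+[n∸m]≡n (≤-trans 1≤k (m≤m+n k _))
  small : 2 * k ∸ 1 < k + k
  small = ≤-reflexive (trans 2k≡ (cong (k +_) (+-identityʳ k)))
  sum≡n : suc t + (2 * k ∸ 1) ≡ n
  sum≡n = trans (sym (+-suc t _)) (trans (cong (t +_) 2k≡) (m∸n+n≡m 2k≤n))

theorem6 : ∃[ n₀ ] (1 ≤ n₀ × (∀ n k → n₀ ≤ n → 2 ≤ k → 2 * k ≤ n →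
    ∀ c d → IsChromaticNumber (KG n k) c → IsGraphDichromaticNumber (KG n k) d →
    c / 16 ≤ d))
theorem6 = 300 , s≤s z≤n , bound
  where
  bound : ∀ n k → 300 ≤ n → 2 ≤ k → 2 * k ≤ n →
    ∀ c d → IsChromaticNumber (KG n k) c → IsGraphDichromaticNumber (KG n k) d → c / 16 ≤ d
  bound zero k () 2≤k 2k≤n c d χ χ⃗
  bound n@(suc n′) k 300≤n 2≤k 2k≤n c d χ (_ , maximal)
    with s , 4s≤t , t≤ ← quarter (n ∸ 2 * k)
    with ℓ , length≤ , many ← sufficient n k s 300≤n 2≤k
           (≤-trans (≤-reflexive (sym (m+[n∸m]≡n 2k≤n))) (+-monoʳ-≤ (2 * k) t≤))
    -- The maximality of d applies only to an orientation with a given dichromatic number, so m has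
    -- to be produced first; the double negation is harmless because the goal is `⊥`.
    = ≮⇒≥ λ d<c/16 → least-exists _ (dicolourable-by-index 1≤k T) λ (m , dicol , min) →
        let h = room m (≤-<-trans (maximal (orientation 1≤k T) m (dicol , min)) d<c/16) in
        not-dicolourable 1≤k T (s≤s z≤n) (many m h) (m≤n⇒m≤1+n (fits m h)) dicol
    where
    open ≤-Reasoning
    1≤k : 1 ≤ k
    1≤k = <⇒≤ 2≤k
    T : Tournament (length (vertices n k)) (suc (2 * ℓ))
    T = tournament {ℓ = ℓ} length≤ ≤-refl
    -- From 16 m + 16 ≤ c ≤ (n - 2 k) + 2 ≤ 4 s + 5, giving up 3 on the left leaves a multiple of 4
    -- after cancelling 5.
    room : ∀ m → m < c / 16 → 4 * m + 2 ≤ s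
    room m m<c/16 = *-cancelˡ-≤ 4 (+-cancelʳ-≤ 5 _ _ (begin
      4 * (4 * m + 2) + 5      ≤⟨ m≤m+n _ 3 ⟩
      4 * (4 * m + 2) + 5 + 3  ≡⟨ regroup m ⟩
      suc m * 16               ≤⟨ *-monoˡ-≤ 16 m<c/16 ⟩
      c / 16 * 16              ≤⟨ m/n*n≤m c 16 ⟩
      c                        ≤⟨ chromatic-upper-bound 1≤k 2k≤n χ ⟩
      (n ∸ 2 * k) + 2          ≤⟨ +-monoˡ-≤ 2 t≤ ⟩
      4 * s + 3 + 2            ≡⟨ +-assoc (4 * s) 3 2 ⟩
      4 * s + 5                ∎))
      where
      regroup : ∀ m → 4 * (4 * m + 2) + 5 + 3 ≡ suc m * 16
      regroup = solve-∀
    -- The term 2 s uses at most half of n - 2 k, and m ≤ s at most another quarter.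
    fits : ∀ m → 4 * m + 2 ≤ s → m + ((k + s) + (k + s)) ≤ n
    fits m h = begin
      m + ((k + s) + (k + s))   ≤⟨ +-monoˡ-≤ _ (≤-trans (m≤m+n m _) (m+n≤o⇒m≤o (4 * m) h)) ⟩
      s + ((k + s) + (k + s))   ≤⟨ m≤m+n _ s ⟩
      s + ((k + s) + (k + s)) + s ≡⟨ regroup k s ⟩
      2 * k + 4 * s             ≤⟨ +-monoʳ-≤ (2 * k) 4s≤t ⟩
      2 * k + (n ∸ 2 * k)       ≡⟨ m+[n∸m]≡n 2k≤n ⟩
      n                         ∎
      where
      regroup : ∀ k s → s + ((k + s) + (k + s)) + s ≡ 2 * k + 4 * s
      regroup = solve-∀
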